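{- Let $1\le k\le n$ and $(\pi,S)\in\mathcal{B}^{>}_{n-1,k-1}$. Then: (a) $\mathrm{fmaj}(\phi^{*}_{n,k}(i,(\pi,S)))=\mathrm{fmaj}((\pi,S))+2i-1$ for every $i\in\{1,\dots,n-k\}$; (b) $\mathrm{fmaj}(\phi^{*}_{ -n,k}(i,(\pi,S)))=\mathrm{fmaj}((\pi,S))+2i-2$ for every $i\in\{1,\dots,n-k\}$; (c) $\mathrm{fmaj}(\phi^{*}_{ -n,k}(0,(\pi,S)))=\mathrm{fmaj}((\pi,S))+2n-2k$.
   Context: For $m\ge0$, $\mathcal{B}_m$ is the group of signed permutations of $[m]$, written $\pi=\pi_1\cdots\pi_m$ with $\pi_0=0$, integers compared in the usual order; $\mathrm{Des}_B(\pi)=\{i\in\{0,\dots,m-1\}:\pi_i>\pi_{i+1}\}$, $\mathrm{neg}(\pi)$ is the number of negative entries, $\mathrm{fmaj}(\pi)=\sum_{i\in\mathrm{Des}_B(\pi)}2i+\mathrm{neg}(\pi)$. Let $\mathcal{B}^{>}_{m,k}=\{(\pi,S):\pi\in\mathcal{B}_m,\ S\subseteq\mathrm{Des}_B(\pi),\ |S|=k\}$; descents in $S$ are called starred. For $\pi\in\mathcal{B}_m$, $\mathrm{fmaj}((\pi,S))=\mathrm{fmaj}(\pi)-\sum_{j\in S}\bigl(2|\mathrm{Des}_B(\pi)\cap\{j,\dots,m-1\}|-1\bigr)$. Gaps and fmaj-labelling: for $(\pi,S)$ with $\pi\in\mathcal{B}_{n-1}$ and $|S|=k-1$, the gaps are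 the $n$ spaces following $\pi_0,\pi_1,\dots,\pi_{n-1}$ (the space following $\pi_j$ lies between $\pi_j$ and $\pi_{j+1}$; the one following $\pi_0$ is at the left end, the one following $\pi_{n-1}$ at the right end); the gap following $\pi_j$ is starred iff $j\in S$. The $n-k+1$ unstarred gaps are labelled $0,1,\dots,n-k$: the rightmost gap gets label $0$; then the unstarred gaps following $\pi_j$ with $j\in\mathrm{Des}_B(\pi)\setminus S$ get labels $1,2,\dots$ from right to left; then the remaining unlabelled unstarred gaps get the next labels in increasing order from left to right. The maps $\phi^{*}_{n,k}:\{1,\dots,n-k\}\times\mathcal{B}^{>}_{n-1,k-1}\to\mathcal{B}^{>}_{n,k}$ and $\phi^{*}_{ -n,k}:\{0,1,\dots,n-k\}\times\mathcal{B}^{>}_{n-1,k-1}\to\mathcal{B}^{>}_{n,k}$ send $(i,(\pi,S))$ to the descent-starred signed permutation obtained by (1) inserting the letter $n$ (resp. $-n$) into the gap with label $i$, giving $\tau\in\mathcal{B}_n$ (stars stay attached to the same gaps between the same letters), (2) moving each star lying to the right of the inserted letter to the nearest descent position of $\tau$ on its left, and (3) placing a star at the rightmost descent of $\tau$. -}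

module Defs where

open import Data.Bool using (Bool; true; false; _∧_; _∨_; not; if_then_else_; T)
open import Data.Nat as ℕ using (ℕ; zero; suc; _*_; _≤ᵇ_; _<ᵇ_; _≡ᵇ_)
open import Data.Integer as ℤ using (ℤ; +_; -[1+_]; ∣_∣)
open import Data.List using (List; []; _∷_; map; upTo; take; drop; _++_; reverse; length; foldr)
open import Data.List.Relation.Binary.Permutation.Propositional using (_↭_)
open import Data.Product using (_×_; _,_)
open import Relation.Nullary using (does)
open import Relation.Binary.PropositionalEquality using (_≡_)

countTrue : List Bool → ℕ
countTrue [] = 0
countTrue (true ∷ bs) = suc (countTrue bs)
countTrue (false ∷ bs) = countTrue bs

at : List Bool → ℕ → Bool
at [] _ = false
at (b ∷ bs) zero = b
at (b ∷ bs) (suc j) = at bs j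

nthOr : ℕ → List ℕ → ℕ → ℕ
nthOr d [] _ = d
nthOr d (x ∷ xs) zero = x
nthOr d (x ∷ xs) (suc j) = nthOr d xs j

filterB : (ℕ → Bool) → List ℕ → List ℕ
filterB p [] = []
filterB p (x ∷ xs) = if p x then x ∷ filterB p xs else filterB p xs

anyB : (ℕ → Bool) → List ℕ → Bool
anyB p [] = false
anyB p (x ∷ xs) = p x ∨ anyB p xs

sumℤ : List ℤ → ℤ
sumℤ = foldr ℤ._+_ (+ 0)

-- Signed permutations of [m]: a word π₁⋯π_m (a list of integers, π₀ = 0
-- implicit) whose absolute values are a permutation of 1,…,m.

oneTo : ℕ → List ℕ
oneTo m = map suc (upTo m)

IsSignedPerm : ℕ → List ℤ → Set
IsSignedPerm m π = map ∣_∣ π ↭ oneTo m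

-- Descent indicator list: entry j (j = 0,…,m-1) is true iff π_j > π_{j+1},
-- with π₀ = 0.
desAux : ℤ → List ℤ → List Bool
desAux a [] = []
desAux a (b ∷ bs) = does (b ℤ.<? a) ∷ desAux b bs

des : List ℤ → List Bool
des π = desAux (+ 0) π

isNeg : ℤ → Bool
isNeg (+ _) = false
isNeg -[1+ _ ] = true

neg : List ℤ → ℕ
neg π = countTrue (map isNeg π)

-- Σ_{j ∈ Des} 2j, where the list entry with index j (offset o) is position o+j
sumMaj : ℕ → List Bool → ℕ
sumMaj o [] = 0
sumMaj o (b ∷ bs) = (if b then 2 * o else 0) ℕ.+ sumMaj (suc o) bs

fmaj : List ℤ → ℕ
fmaj π = sumMaj 0 (des π) ℕ.+ neg π

-- Descent-starred signed permutations (π , S), with S encoded as a Bool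
-- list s of length m: j ∈ S iff entry j of s is true.

InBgt : ℕ → ℕ → List ℤ → List Bool → Set
InBgt m k π s =
  IsSignedPerm m π
  × length s ≡ m
  × (∀ j → T (at s j) → T (at (des π) j))
  × countTrue s ≡ k

fmajS : List ℤ × List Bool → ℤ
fmajS (π , s) =
  + fmaj π ℤ.- sumℤ (map term (upTo (length π)))
  where
  term : ℕ → ℤ
  term j = if at s j
           then (+ (2 * countTrue (drop j (des π))) ℤ.- + 1)
           else + 0

-- Gaps are indexed by g ∈ {0,…,m}: gap g follows π_g.
-- labelOrder lists the unstarred gaps in the order of their labels
-- 0,1,…,n-k: first the rightmost gap m, then the unstarred descent gaps
-- from right to left, then the remaining unstarred gaps left to right.

labelOrder : List ℤ → List Bool → List ℕ
labelOrder π s =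
  m ∷ (reverse (filterB (λ j → at d j ∧ not (at s j)) (upTo m))
       ++ filterB (λ j → not (at s j) ∧ not (at d j)) (upTo m))
  where
  m = length π
  d = des π

gapOf : List ℤ → List Bool → ℕ → ℕ
gapOf π s i = nthOr 0 (labelOrder π s) i

-- largest d < p with d a descent position (default 0 if none)
prevDes : List Bool → ℕ → ℕ
prevDes dτ zero = 0
prevDes dτ (suc p) = if at dτ p then p else prevDes dτ p

rightmostDes : List Bool → ℕ
rightmostDes dτ = prevDes dτ (length dτ)

phi : ℤ → ℕ → List ℤ × List Bool → List ℤ × List Bool
phi x i (π , s) = τ , map newStar (upTo (length τ))
  where
  g  = gapOf π s i
  -- (1) insert x into gap g; stars stay attached to the same gaps
  τ  = take g π ++ (x ∷ drop g π)
  s' = take g s ++ (false ∷ drop g s)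
  dτ = des τ
  -- x is τ_{g+1}; the gap following τ_p lies to its right iff g < p.
  -- (2) stars right of x move to the nearest descent strictly on their left;
  -- (3) a star is placed on the rightmost descent of τ.
  newStar : ℕ → Bool
  newStar q =
    ((q ≤ᵇ g) ∧ at s' q)
    ∨ anyB (λ p → (g <ᵇ p) ∧ at s' p ∧ (prevDes dτ p ≡ᵇ q)) (upTo (length τ))
    ∨ (q ≡ᵇ rightmostDes dτ)

phiPos : ℕ → ℕ → List ℤ × List Bool → List ℤ × List Bool
phiPos n = phi (+ n)

phiNeg : ℕ → ℕ → List ℤ × List Bool → List ℤ × List Bool
phiNeg n = phi (ℤ.- (+ n))

{-
Write fmaj((π,S)) = fmaj(π) + |S| − Σ_{j∈S} 2·|Des_B(π) ∩ {j,…}|. Inserting into gap g a letter x whose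
absolute value exceeds all others replaces the descent bit e of that gap by the pair ([x<0], [x>0]), shifts
every later descent position by one and adds [x<0] negative letters. Stars left of x stay; every star right of
x moves to the next descent on its left and the rightmost descent receives a new star, so each of them gains
exactly one descent to its right. Counting these changes expresses the increase of fmaj through g, e, the stars
on either side of g and the descents right of g. For the gap with label i ≥ 1 the labelling rule links these
numbers: for an unstarred descent, i − 1 counts the unstarred descents to its right; for a non-descent,
(i − 1) + (k − 1) = g + #(descents right of g). Either way the increase is 2i − 1 − [x<0]. Label 0 is the right
end, where −n adds one descent and one star.
-}
module Submission where

open import Defs
open import Data.Bool using (Bool; true; false; _∧_; _∨_; not; if_then_else_; T)
open import Data.Bool.Properties using (∨-zeroʳ; ∨-identityʳ; ∧-assoc; ∧-zeroʳ)
open import Data.Nat as ℕ using (ℕ; zero; suc; _+_; _*_; _∸_; _≤_; _<_; z≤n; s≤s; _≤ᵇ_; _<ᵇ_; _≡ᵇ_)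
import Data.Nat.Properties as ℕₚ
open import Algebra.Properties.CommutativeSemigroup ℕₚ.+-commutativeSemigroup using () renaming (interchange to +-interchange)
import Data.Nat.Tactic.RingSolver as ℕSolver
open import Data.Integer as ℤ using (ℤ; +_; -[1+_]; ∣_∣; +<+; -<+; -<-)
import Data.Integer.Properties as ℤₚ
import Data.Integer.Tactic.RingSolver as ℤSolver
open import Data.List using (List; []; _∷_; map; upTo; take; drop; _++_; reverse; length; replicate)
import Data.List.Properties as Listₚ
open import Data.List.Membership.Propositional using (_∈_)
import Data.List.Membership.Propositional.Properties as ∈ₚ
open import Data.List.Relation.Unary.Any using (here; there)
import Data.List.Relation.Binary.Permutation.Propositional.Properties as ↭ₚ
open import Data.Product using (Σ; _×_; _,_; proj₁; proj₂)
open import Data.Sum using (_⊎_; inj₁; inj₂; [_,_]′)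
open import Data.Empty using (⊥; ⊥-elim)
open import Function using (_∘_)
open import Relation.Binary.Definitions using (tri<; tri≈; tri>)
open import Relation.Binary.PropositionalEquality
open import Relation.Nullary using (does; yes; no)
open import Relation.Nullary.Decidable using (dec-true; dec-false)

bit : Bool → ℕ
bit true = 1
bit false = 0

if-then-0 : ∀ b x → (if b then x else 0) ≡ bit b * x
if-then-0 true x = sym (ℕₚ.+-identityʳ x)
if-then-0 false x = refl

cong₃ : ∀ {A B C D : Set} (f : A → B → C → D) {a a′ b b′ c c′} → a ≡ a′ → b ≡ b′ → c ≡ c′ → f a b c ≡ f a′ b′ c′
cong₃ f refl refl refl = refl

if-true : ∀ {A : Set} {b} (x y : A) → b ≡ true → (if b then x else y) ≡ x
if-true x y refl = refl

if-false : ∀ {A : Set} {b} (x y : A) → b ≡ false → (if b then x else y) ≡ y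
if-false x y refl = refl

∧-≡true⁺ : ∀ {x y} → x ≡ true → y ≡ true → x ∧ y ≡ true
∧-≡true⁺ refl refl = refl

∧-≡true⁻ : ∀ x y → x ∧ y ≡ true → x ≡ true × y ≡ true
∧-≡true⁻ true true _ = refl , refl

∧-not-≡true⁻ : ∀ x y → x ∧ not y ≡ true → x ≡ true × y ≡ false
∧-not-≡true⁻ true false _ = refl , refl

not-∧-not-≡true⁻ : ∀ x y → not x ∧ not y ≡ true → x ≡ false × y ≡ false
not-∧-not-≡true⁻ false false _ = refl , refl

∨-≡true⁻ : ∀ x y → x ∨ y ≡ true → x ≡ true ⊎ y ≡ true
∨-≡true⁻ true y _ = inj₁ refl
∨-≡true⁻ false y h = inj₂ h

∨-≡trueʳ : ∀ x {y} → y ≡ true → x ∨ y ≡ true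
∨-≡trueʳ x refl = ∨-zeroʳ x

≡-from-≡true⇔ : ∀ x y → (x ≡ true → y ≡ true) → (y ≡ true → x ≡ true) → x ≡ y
≡-from-≡true⇔ true y to from = sym (to refl)
≡-from-≡true⇔ false true to from = from refl
≡-from-≡true⇔ false false to from = refl

≡ᵇ-refl : ∀ q → (q ≡ᵇ q) ≡ true
≡ᵇ-refl zero = refl
≡ᵇ-refl (suc q) = ≡ᵇ-refl q

≡ᵇ⇒≡ : ∀ a b → (a ≡ᵇ b) ≡ true → a ≡ b
≡ᵇ⇒≡ zero zero _ = refl
≡ᵇ⇒≡ (suc a) (suc b) h = cong suc (≡ᵇ⇒≡ a b h)

T⇒≡true : ∀ {b} → T b → b ≡ true
T⇒≡true {true} _ = refl

¬T⇒≡false : ∀ {b} → (T b → ⊥) → b ≡ false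
¬T⇒≡false {true} ¬t = ⊥-elim (¬t _)
¬T⇒≡false {false} _ = refl

<⇒∃-suc-+ : ∀ {q p} → q < p → Σ ℕ λ c → p ≡ suc q + c
<⇒∃-suc-+ {q} {p} q<p = p ∸ suc q , sym (ℕₚ.m+[n∸m]≡n q<p)

first : List Bool → Bool
first [] = false
first (b ∷ _) = b

rest : List Bool → List Bool
rest [] = []
rest (_ ∷ bs) = bs

countTrue-∷ : ∀ b bs → countTrue (b ∷ bs) ≡ bit b + countTrue bs
countTrue-∷ true bs = refl
countTrue-∷ false bs = refl

countTrue-first-rest : ∀ bs → countTrue bs ≡ bit (first bs) + countTrue (rest bs)
countTrue-first-rest [] = refl
countTrue-first-rest (b ∷ bs) = countTrue-∷ b bs

countTrue-++ : ∀ xs ys → countTrue (xs ++ ys) ≡ countTrue xs + countTrue ys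
countTrue-++ [] ys = refl
countTrue-++ (true ∷ xs) ys = cong suc (countTrue-++ xs ys)
countTrue-++ (false ∷ xs) ys = countTrue-++ xs ys

countTrue-take-drop : ∀ r bs → countTrue bs ≡ countTrue (take r bs) + countTrue (drop r bs)
countTrue-take-drop r bs = trans (cong countTrue (sym (Listₚ.take++drop≡id r bs))) (countTrue-++ (take r bs) (drop r bs))

countTrue-allFalse : ∀ bs → (∀ j → at bs j ≡ true → ⊥) → countTrue bs ≡ 0
countTrue-allFalse [] _ = refl
countTrue-allFalse (true ∷ bs) h = ⊥-elim (h 0 refl)
countTrue-allFalse (false ∷ bs) h = countTrue-allFalse bs (h ∘ suc)

at-rest : ∀ bs j → at bs (suc j) ≡ at (rest bs) j
at-rest [] j = refl
at-rest (b ∷ bs) j = refl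

at-zero : ∀ bs → at bs 0 ≡ first bs
at-zero [] = refl
at-zero (b ∷ bs) = refl

at-drop : ∀ k bs r → at (drop k bs) r ≡ at bs (k + r)
at-drop zero bs r = refl
at-drop (suc k) [] r = refl
at-drop (suc k) (b ∷ bs) r = at-drop k bs r

at-++ˡ : ∀ xs ys q → q < length xs → at (xs ++ ys) q ≡ at xs q
at-++ˡ (x ∷ xs) ys zero _ = refl
at-++ˡ (x ∷ xs) ys (suc q) (s≤s q<) = at-++ˡ xs ys q q<

at-++ʳ : ∀ xs ys r → at (xs ++ ys) (length xs + r) ≡ at ys r
at-++ʳ [] ys r = refl
at-++ʳ (x ∷ xs) ys r = at-++ʳ xs ys r

at-++-length : ∀ xs ys → at (xs ++ ys) (length xs) ≡ at ys 0
at-++-length xs ys = trans (cong (at (xs ++ ys)) (sym (ℕₚ.+-identityʳ (length xs)))) (at-++ʳ xs ys 0)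

at-++-suc : ∀ xs y ys r → at (xs ++ y ∷ ys) (suc (length xs + r)) ≡ at ys r
at-++-suc xs y ys r = trans (cong (at (xs ++ y ∷ ys)) (sym (ℕₚ.+-suc (length xs) r))) (at-++ʳ xs (y ∷ ys) (suc r))

at-replicate : ∀ g q → at (replicate g false) q ≡ false
at-replicate zero q = refl
at-replicate (suc g) zero = refl
at-replicate (suc g) (suc q) = at-replicate g q

at-≥length : ∀ bs j → length bs ≤ j → at bs j ≡ false
at-≥length [] j _ = refl
at-≥length (b ∷ bs) (suc j) (s≤s le) = at-≥length bs j le

at-true⇒<length : ∀ bs j → at bs j ≡ true → j < length bs
at-true⇒<length (b ∷ bs) zero _ = s≤s z≤n
at-true⇒<length (b ∷ bs) (suc j) h = s≤s (at-true⇒<length bs j h)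

drop-at : ∀ g bs → g < length bs → drop g bs ≡ at bs g ∷ drop (suc g) bs
drop-at zero (b ∷ bs) _ = refl
drop-at (suc g) (b ∷ bs) (s≤s g<) = drop-at g bs g<

drop-rest : ∀ n bs → drop n (rest bs) ≡ drop (suc n) bs
drop-rest n [] = Listₚ.drop-[] n
drop-rest n (b ∷ bs) = refl

_⊆ᵇ_ : List Bool → List Bool → Set
W ⊆ᵇ D = ∀ j → at W j ≡ true → at D j ≡ true

rest-⊆ᵇ : ∀ e D W → W ⊆ᵇ (e ∷ D) → rest W ⊆ᵇ D
rest-⊆ᵇ e D W h j w = h (suc j) (trans (at-rest W j) w)

first-⊆ᵇ-false : ∀ D W → W ⊆ᵇ (false ∷ D) → first W ≡ false
first-⊆ᵇ-false D [] h = refl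
first-⊆ᵇ-false D (false ∷ W) h = refl
first-⊆ᵇ-false D (true ∷ W) h with h 0 refl
... | ()

sumMaj-suc : ∀ o D → sumMaj (suc o) D ≡ sumMaj o D + 2 * countTrue D
sumMaj-suc o [] = refl
sumMaj-suc o (true ∷ D) =
  trans (cong (λ z → 2 * suc o + z) (sumMaj-suc (suc o) D)) (shuffle o (sumMaj (suc o) D) (countTrue D))
  where
  shuffle : ∀ a b c → 2 * suc a + (b + 2 * c) ≡ 2 * a + b + 2 * suc c
  shuffle = ℕSolver.solve-∀
sumMaj-suc o (false ∷ D) = sumMaj-suc (suc o) D

sumMaj-++ : ∀ o xs ys → sumMaj o (xs ++ ys) ≡ sumMaj o xs + sumMaj (o + length xs) ys
sumMaj-++ o [] ys = cong (λ o′ → sumMaj o′ ys) (sym (ℕₚ.+-identityʳ o))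
sumMaj-++ o (b ∷ xs) ys = begin
  (if b then 2 * o else 0) + sumMaj (suc o) (xs ++ ys)
    ≡⟨ cong (λ z → (if b then 2 * o else 0) + z) (sumMaj-++ (suc o) xs ys) ⟩
  (if b then 2 * o else 0) + (sumMaj (suc o) xs + sumMaj (suc o + length xs) ys)
    ≡⟨ cong (λ o′ → (if b then 2 * o else 0) + (sumMaj (suc o) xs + sumMaj o′ ys)) (sym (ℕₚ.+-suc o (length xs))) ⟩
  (if b then 2 * o else 0) + (sumMaj (suc o) xs + sumMaj (o + suc (length xs)) ys)
    ≡⟨ sym (ℕₚ.+-assoc (if b then 2 * o else 0) _ _) ⟩
  sumMaj o (b ∷ xs) + sumMaj (o + length (b ∷ xs)) ys ∎
  where open ≡-Reasoning

sumMaj-∷ : ∀ o e D → sumMaj o (e ∷ D) ≡ bit e * (2 * o) + sumMaj (suc o) D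
sumMaj-∷ o e D = cong (_+ sumMaj (suc o) D) (if-then-0 e (2 * o))

neg-∷ : ∀ x π → neg (x ∷ π) ≡ bit (isNeg x) + neg π
neg-∷ x π = countTrue-∷ (isNeg x) (map isNeg π)

neg-++ : ∀ xs ys → neg (xs ++ ys) ≡ neg xs + neg ys
neg-++ xs ys = trans (cong countTrue (Listₚ.map-++ isNeg xs ys)) (countTrue-++ (map isNeg xs) (map isNeg ys))

starCost : List Bool → List Bool → ℕ
starCost [] W = 0
starCost (e ∷ D) W = bit (first W) * (2 * countTrue (e ∷ D)) + starCost D (rest W)

starCost-++ : ∀ xs ys as bs → length xs ≡ length as →
  starCost (xs ++ ys) (as ++ bs) ≡ starCost xs as + 2 * (countTrue ys * countTrue as) + starCost ys bs
starCost-++ [] ys [] bs _ = cong (λ z → 2 * z + starCost ys bs) (sym (ℕₚ.*-zeroʳ (countTrue ys)))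
starCost-++ (x ∷ xs) ys (a ∷ as) bs len = begin
  bit a * (2 * countTrue (x ∷ xs ++ ys)) + starCost (xs ++ ys) (as ++ bs)
    ≡⟨ cong₂ (λ c r → bit a * (2 * c) + r) (countTrue-++ (x ∷ xs) ys) (starCost-++ xs ys as bs (ℕₚ.suc-injective len)) ⟩
  bit a * (2 * (countTrue (x ∷ xs) + countTrue ys)) + (starCost xs as + 2 * (countTrue ys * countTrue as) + starCost ys bs)
    ≡⟨ shuffle (bit a) (countTrue (x ∷ xs)) (countTrue ys) (starCost xs as) (countTrue as) (starCost ys bs) ⟩
  bit a * (2 * countTrue (x ∷ xs)) + starCost xs as + 2 * (countTrue ys * (bit a + countTrue as)) + starCost ys bs
    ≡⟨ cong (λ c → bit a * (2 * countTrue (x ∷ xs)) + starCost xs as + 2 * (countTrue ys * c) + starCost ys bs) (sym (countTrue-∷ a as)) ⟩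
  starCost (x ∷ xs) (a ∷ as) + 2 * (countTrue ys * countTrue (a ∷ as)) + starCost ys bs ∎
  where
  open ≡-Reasoning
  shuffle : ∀ ba cx cy qa ca qb → ba * (2 * (cx + cy)) + (qa + 2 * (cy * ca) + qb)
            ≡ ba * (2 * cx) + qa + 2 * (cy * (ba + ca)) + qb
  shuffle = ℕSolver.solve-∀

length-desAux : ∀ a π → length (desAux a π) ≡ length π
length-desAux a [] = refl
length-desAux a (b ∷ π) = cong suc (length-desAux b π)

map-upTo-suc : ∀ {A : Set} (f : ℕ → A) L → map f (upTo (suc L)) ≡ f 0 ∷ map (f ∘ suc) (upTo L)
map-upTo-suc f L = cong (f 0 ∷_) (trans (Listₚ.map-applyUpTo suc f L) (sym (Listₚ.map-upTo (f ∘ suc) L)))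

starTerm : List Bool → List Bool → ℕ → ℤ
starTerm d s j = if at s j then + (2 * countTrue (drop j d)) ℤ.- + 1 else + 0

sum-starTerm : ∀ L d s → length d ≡ L → length s ≡ L →
  sumℤ (map (starTerm d s) (upTo L)) ≡ + starCost d s ℤ.- + countTrue s
sum-starTerm zero [] [] _ _ = refl
sum-starTerm (suc L) (e ∷ d) (f ∷ s) ld ls = begin
  sumℤ (map (starTerm (e ∷ d) (f ∷ s)) (upTo (suc L)))
    ≡⟨ cong sumℤ (map-upTo-suc (starTerm (e ∷ d) (f ∷ s)) L) ⟩
  starTerm (e ∷ d) (f ∷ s) 0 ℤ.+ sumℤ (map (starTerm d s) (upTo L))
    ≡⟨ cong (λ z → starTerm (e ∷ d) (f ∷ s) 0 ℤ.+ z) (sum-starTerm L d s (ℕₚ.suc-injective ld) (ℕₚ.suc-injective ls)) ⟩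
  starTerm (e ∷ d) (f ∷ s) 0 ℤ.+ (+ starCost d s ℤ.- + countTrue s)
    ≡⟨ head-step f ⟩
  + starCost (e ∷ d) (f ∷ s) ℤ.- + countTrue (f ∷ s) ∎
  where
  open ≡-Reasoning
  regroup : ∀ (a b c : ℤ) → (a ℤ.- + 1) ℤ.+ (b ℤ.- c) ≡ (a ℤ.+ b) ℤ.- (+ 1 ℤ.+ c)
  regroup = ℤSolver.solve-∀
  head-step : ∀ f → starTerm (e ∷ d) (f ∷ s) 0 ℤ.+ (+ starCost d s ℤ.- + countTrue s)
                    ≡ + starCost (e ∷ d) (f ∷ s) ℤ.- + countTrue (f ∷ s)
  head-step true = trans (regroup (+ (2 * countTrue (e ∷ d))) (+ starCost d s) (+ countTrue s))
    (cong₂ ℤ._-_ (sym (trans (cong (λ z → + (z + starCost d s)) (ℕₚ.*-identityˡ (2 * countTrue (e ∷ d))))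
                              (ℤₚ.pos-+ (2 * countTrue (e ∷ d)) (starCost d s))))
                 (sym (ℤₚ.pos-+ 1 (countTrue s))))
  head-step false = ℤₚ.+-identityˡ _

fmajS⁺ : List ℤ × List Bool → ℕ
fmajS⁺ (π , s) = fmaj π + countTrue s

fmajS⁻ : List ℤ × List Bool → ℕ
fmajS⁻ (π , s) = starCost (des π) s

fmajS-closedForm : ∀ π s → length s ≡ length π → fmajS (π , s) ≡ + fmajS⁺ (π , s) ℤ.- + fmajS⁻ (π , s)
fmajS-closedForm π s ls = begin
  + fmaj π ℤ.- sumℤ (map (starTerm (des π) s) (upTo (length π)))
    ≡⟨ cong (λ z → + fmaj π ℤ.- z) (sum-starTerm (length π) (des π) s (length-desAux (+ 0) π) ls) ⟩
  + fmaj π ℤ.- (+ starCost (des π) s ℤ.- + countTrue s)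
    ≡⟨ regroup (+ fmaj π) (+ starCost (des π) s) (+ countTrue s) ⟩
  (+ fmaj π ℤ.+ + countTrue s) ℤ.- + starCost (des π) s
    ≡⟨ cong (ℤ._- + starCost (des π) s) (sym (ℤₚ.pos-+ (fmaj π) (countTrue s))) ⟩
  + (fmaj π + countTrue s) ℤ.- + starCost (des π) s ∎
  where
  open ≡-Reasoning
  regroup : ∀ (a b c : ℤ) → a ℤ.- (b ℤ.- c) ≡ (a ℤ.+ c) ℤ.- b
  regroup = ℤSolver.solve-∀

pos-diff-shift : ∀ a b c d i l → a + d + l ≡ c + b + i → + a ℤ.- + b ≡ + c ℤ.- + d ℤ.+ + i ℤ.- + l
pos-diff-shift a b c d i l eq = begin
  + a ℤ.- + b
    ≡⟨ regroup₁ (+ a) (+ b) (+ d) (+ l) ⟩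
  (+ a ℤ.+ + d ℤ.+ + l) ℤ.- (+ b ℤ.+ + d ℤ.+ + l)
    ≡⟨ cong (ℤ._- (+ b ℤ.+ + d ℤ.+ + l)) (trans (sym (pos-+₃ a d l)) (trans (cong +_ eq) (pos-+₃ c b i))) ⟩
  (+ c ℤ.+ + b ℤ.+ + i) ℤ.- (+ b ℤ.+ + d ℤ.+ + l)
    ≡⟨ regroup₂ (+ c) (+ b) (+ d) (+ i) (+ l) ⟩
  + c ℤ.- + d ℤ.+ + i ℤ.- + l ∎
  where
  open ≡-Reasoning
  pos-+₃ : ∀ x y z → + (x + y + z) ≡ + x ℤ.+ + y ℤ.+ + z
  pos-+₃ x y z = trans (ℤₚ.pos-+ (x + y) z) (cong (ℤ._+ + z) (ℤₚ.pos-+ x y))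
  regroup₁ : ∀ (a b d l : ℤ) → a ℤ.- b ≡ (a ℤ.+ d ℤ.+ l) ℤ.- (b ℤ.+ d ℤ.+ l)
  regroup₁ = ℤSolver.solve-∀
  regroup₂ : ∀ (c b d i l : ℤ) → (c ℤ.+ b ℤ.+ i) ℤ.- (b ℤ.+ d ℤ.+ l) ≡ c ℤ.- d ℤ.+ i ℤ.- l
  regroup₂ = ℤSolver.solve-∀

fmajS-shift : ∀ p q i l → length (proj₂ p) ≡ length (proj₁ p) → length (proj₂ q) ≡ length (proj₁ q) →
  fmajS⁺ q + fmajS⁻ p + l ≡ fmajS⁺ p + fmajS⁻ q + i → fmajS q ≡ fmajS p ℤ.+ + i ℤ.- + l
fmajS-shift (π , s) (τ , t) i l ls lt eq = begin
  fmajS (τ , t)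
    ≡⟨ fmajS-closedForm τ t lt ⟩
  + fmajS⁺ (τ , t) ℤ.- + fmajS⁻ (τ , t)
    ≡⟨ pos-diff-shift (fmajS⁺ (τ , t)) (fmajS⁻ (τ , t)) (fmajS⁺ (π , s)) (fmajS⁻ (π , s)) i l eq ⟩
  + fmajS⁺ (π , s) ℤ.- + fmajS⁻ (π , s) ℤ.+ + i ℤ.- + l
    ≡⟨ cong (λ z → z ℤ.+ + i ℤ.- + l) (sym (fmajS-closedForm π s ls)) ⟩
  fmajS (π , s) ℤ.+ + i ℤ.- + l ∎
  where open ≡-Reasoning

lastOr : ℤ → List ℤ → ℤ
lastOr a [] = a
lastOr a (x ∷ xs) = lastOr x xs

desAux-++ : ∀ a xs ys → desAux a (xs ++ ys) ≡ desAux a xs ++ desAux (lastOr a xs) ys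
desAux-++ a [] ys = refl
desAux-++ a (x ∷ xs) ys = cong (_ ∷_) (desAux-++ x xs ys)

fmajS⁺-++ : ∀ πL πR sL sR → let dR = desAux (lastOr (+ 0) πL) πR in
  fmajS⁺ (πL ++ πR , sL ++ sR) ≡ fmajS⁺ (πL , sL) + (sumMaj (length πL) dR + neg πR + countTrue sR)
fmajS⁺-++ πL πR sL sR = begin
  sumMaj 0 (des (πL ++ πR)) + neg (πL ++ πR) + countTrue (sL ++ sR)
    ≡⟨ cong₂ (λ m c → m + neg (πL ++ πR) + c)
             (trans (cong (sumMaj 0) (desAux-++ (+ 0) πL πR)) (sumMaj-++ 0 (des πL) dR))
             (countTrue-++ sL sR) ⟩
  sumMaj 0 (des πL) + sumMaj (length (des πL)) dR + neg (πL ++ πR) + (countTrue sL + countTrue sR)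
    ≡⟨ cong₂ (λ l n → sumMaj 0 (des πL) + sumMaj l dR + n + (countTrue sL + countTrue sR))
             (length-desAux (+ 0) πL) (neg-++ πL πR) ⟩
  sumMaj 0 (des πL) + sumMaj (length πL) dR + (neg πL + neg πR) + (countTrue sL + countTrue sR)
    ≡⟨ shuffle (sumMaj 0 (des πL)) (sumMaj (length πL) dR) (neg πL) (neg πR) (countTrue sL) (countTrue sR) ⟩
  sumMaj 0 (des πL) + neg πL + countTrue sL + (sumMaj (length πL) dR + neg πR + countTrue sR) ∎
  where
  open ≡-Reasoning
  dR = desAux (lastOr (+ 0) πL) πR
  shuffle : ∀ a b c d e f → a + b + (c + d) + (e + f) ≡ a + c + e + (b + d + f)
  shuffle = ℕSolver.solve-∀

fmajS⁻-++ : ∀ πL πR sL sR → length sL ≡ length πL → let dR = desAux (lastOr (+ 0) πL) πR in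
  fmajS⁻ (πL ++ πR , sL ++ sR) ≡ fmajS⁻ (πL , sL) + 2 * (countTrue dR * countTrue sL) + starCost dR sR
fmajS⁻-++ πL πR sL sR ls =
  trans (cong (λ d → starCost d (sL ++ sR)) (desAux-++ (+ 0) πL πR))
        (starCost-++ (des πL) _ sL sR (trans (length-desAux (+ 0) πL) (sym ls)))

⊆ᵇ[]⇒countTrue≡0 : ∀ W → W ⊆ᵇ [] → countTrue W ≡ 0
⊆ᵇ[]⇒countTrue≡0 W h = countTrue-allFalse W (λ j w → false≢true (h j w))
  where
  false≢true : false ≡ true → ⊥
  false≢true ()

starOfFirstDes : Bool → List Bool → List Bool → Bool
starOfFirstDes b [] W = b
starOfFirstDes b (e ∷ D) W = if e then first W else starOfFirstDes b D (rest W)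

-- Every descent of D takes over the star of the next descent to its right; the last descent gets b.
passStars : Bool → List Bool → List Bool → List Bool
passStars b [] W = []
passStars b (e ∷ D) W = (e ∧ starOfFirstDes b D (rest W)) ∷ passStars b D (rest W)

length-passStars : ∀ b D W → length (passStars b D W) ≡ length D
length-passStars b [] W = refl
length-passStars b (e ∷ D) W = cong suc (length-passStars b D (rest W))

countTrue-passStars : ∀ b D W → W ⊆ᵇ D →
  countTrue (passStars b D W) + bit (starOfFirstDes b D W) ≡ countTrue W + bit b
countTrue-passStars b [] W h = cong (_+ bit b) (sym (⊆ᵇ[]⇒countTrue≡0 W h))
countTrue-passStars b (true ∷ D) W h = begin
  countTrue (f ∷ passStars b D (rest W)) + bit (first W)
    ≡⟨ cong (_+ bit (first W)) (countTrue-∷ f (passStars b D (rest W))) ⟩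
  bit f + countTrue (passStars b D (rest W)) + bit (first W)
    ≡⟨ cong (_+ bit (first W)) (ℕₚ.+-comm (bit f) _) ⟩
  countTrue (passStars b D (rest W)) + bit f + bit (first W)
    ≡⟨ cong (_+ bit (first W)) (countTrue-passStars b D (rest W) (rest-⊆ᵇ true D W h)) ⟩
  countTrue (rest W) + bit b + bit (first W)
    ≡⟨ shuffle (countTrue (rest W)) (bit b) (bit (first W)) ⟩
  bit (first W) + countTrue (rest W) + bit b
    ≡⟨ cong (_+ bit b) (sym (countTrue-first-rest W)) ⟩
  countTrue W + bit b ∎
  where
  open ≡-Reasoning
  f = starOfFirstDes b D (rest W)
  shuffle : ∀ x y z → x + y + z ≡ z + x + y
  shuffle = ℕSolver.solve-∀
countTrue-passStars b (false ∷ D) W h =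
  trans (countTrue-passStars b D (rest W) (rest-⊆ᵇ false D W h))
        (cong (_+ bit b) (trans (cong (λ z → bit z + countTrue (rest W)) (sym (first-⊆ᵇ-false D W h)))
                                (sym (countTrue-first-rest W))))

-- Passing a star to the next descent on its left raises its descent count by one.
starCost-passStars : ∀ b D W → W ⊆ᵇ D →
  starCost D (passStars b D W) + bit (starOfFirstDes b D W) * (2 * suc (countTrue D))
    ≡ starCost D W + 2 * countTrue W + bit b * 2
starCost-passStars b [] W h = cong (λ z → 2 * z + bit b * 2) (sym (⊆ᵇ[]⇒countTrue≡0 W h))
starCost-passStars b (true ∷ D) W h = begin
  bit f * (2 * suc c) + starCost D (passStars b D (rest W)) + bit (first W) * (2 * suc (suc c))
    ≡⟨ cong (_+ bit (first W) * (2 * suc (suc c))) (ℕₚ.+-comm (bit f * (2 * suc c)) _) ⟩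
  starCost D (passStars b D (rest W)) + bit f * (2 * suc c) + bit (first W) * (2 * suc (suc c))
    ≡⟨ cong (_+ bit (first W) * (2 * suc (suc c))) (starCost-passStars b D (rest W) (rest-⊆ᵇ true D W h)) ⟩
  starCost D (rest W) + 2 * countTrue (rest W) + bit b * 2 + bit (first W) * (2 * suc (suc c))
    ≡⟨ shuffle (bit (first W)) c (starCost D (rest W)) (countTrue (rest W)) (bit b) ⟩
  bit (first W) * (2 * suc c) + starCost D (rest W) + 2 * (bit (first W) + countTrue (rest W)) + bit b * 2
    ≡⟨ cong (λ z → bit (first W) * (2 * suc c) + starCost D (rest W) + 2 * z + bit b * 2) (sym (countTrue-first-rest W)) ⟩
  starCost (true ∷ D) W + 2 * countTrue W + bit b * 2 ∎
  where
  open ≡-Reasoning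
  f = starOfFirstDes b D (rest W)
  c = countTrue D
  shuffle : ∀ h c q w b → q + 2 * w + b * 2 + h * (2 * suc (suc c)) ≡ h * (2 * suc c) + q + 2 * (h + w) + b * 2
  shuffle = ℕSolver.solve-∀
starCost-passStars b (false ∷ D) W h =
  trans (starCost-passStars b D (rest W) (rest-⊆ᵇ false D W h))
        (cong₂ (λ x y → x + 2 * y + bit b * 2)
               (cong (λ z → bit z * (2 * countTrue D) + starCost D (rest W)) (sym first≡false))
               (trans (cong (λ z → bit z + countTrue (rest W)) (sym first≡false)) (sym (countTrue-first-rest W))))
  where
  first≡false = first-⊆ᵇ-false D W h

starOfFirstDes-++ : ∀ b xs ys as bs → length xs ≡ length as →
  starOfFirstDes b (xs ++ ys) (as ++ bs) ≡ starOfFirstDes (starOfFirstDes b ys bs) xs as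
starOfFirstDes-++ b [] ys [] bs _ = refl
starOfFirstDes-++ b (x ∷ xs) ys (a ∷ as) bs len =
  cong (if x then a else_) (starOfFirstDes-++ b xs ys as bs (ℕₚ.suc-injective len))

passStars-++ : ∀ b xs ys as bs → length xs ≡ length as →
  passStars b (xs ++ ys) (as ++ bs) ≡ passStars (starOfFirstDes b ys bs) xs as ++ passStars b ys bs
passStars-++ b [] ys [] bs _ = refl
passStars-++ b (x ∷ xs) ys (a ∷ as) bs len =
  cong₂ _∷_ (cong (x ∧_) (starOfFirstDes-++ b xs ys as bs (ℕₚ.suc-injective len)))
            (passStars-++ b xs ys as bs (ℕₚ.suc-injective len))

starOfFirstDes-unstarred : ∀ D → starOfFirstDes false D (replicate (length D) false) ≡ false
starOfFirstDes-unstarred [] = refl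
starOfFirstDes-unstarred (true ∷ D) = refl
starOfFirstDes-unstarred (false ∷ D) = starOfFirstDes-unstarred D

passStars-unstarred : ∀ D → passStars false D (replicate (length D) false) ≡ replicate (length D) false
passStars-unstarred [] = refl
passStars-unstarred (e ∷ D) =
  cong₂ _∷_ (trans (cong (e ∧_) (starOfFirstDes-unstarred D)) (∧-zeroʳ e)) (passStars-unstarred D)

passStars-unstarred-++ : ∀ b xs ys bs → starOfFirstDes b ys bs ≡ false →
  passStars b (xs ++ ys) (replicate (length xs) false ++ bs) ≡ replicate (length xs) false ++ passStars b ys bs
passStars-unstarred-++ b xs ys bs first≡false =
  trans (passStars-++ b xs ys (replicate (length xs) false) bs (sym (Listₚ.length-replicate (length xs))))
        (cong (_++ passStars b ys bs) (trans (cong (λ b′ → passStars b′ xs (replicate (length xs) false)) first≡false)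
                                             (passStars-unstarred xs)))

at-passStars : ∀ b D W q →
  at (passStars b D W) q ≡ at D q ∧ starOfFirstDes b (drop (suc q) D) (drop (suc q) W)
at-passStars b [] W q = refl
at-passStars b (e ∷ D) W zero = cong (λ z → e ∧ starOfFirstDes b D z) (drop-rest 0 W)
at-passStars b (e ∷ D) W (suc q) =
  trans (at-passStars b D (rest W) q)
        (cong (λ z → at D q ∧ starOfFirstDes b (drop (suc q) D) z) (drop-rest (suc q) W))

starOfFirstDes-noDes : ∀ b D W → (∀ r → at D r ≡ false) → starOfFirstDes b D W ≡ b
starOfFirstDes-noDes b [] W _ = refl
starOfFirstDes-noDes b (e ∷ D) W h with e | h 0
... | .false | refl = starOfFirstDes-noDes b D (rest W) (h ∘ suc)

starOfFirstDes-firstDes : ∀ b D W p → at D p ≡ true → (∀ r → r < p → at D r ≡ false) →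
  starOfFirstDes b D W ≡ at W p
starOfFirstDes-firstDes b (e ∷ D) W zero hp _ with e | hp
... | .true | refl = sym (at-zero W)
starOfFirstDes-firstDes b (e ∷ D) W (suc p) hp before with e | before 0 (s≤s z≤n)
... | .false | refl =
  trans (starOfFirstDes-firstDes b D (rest W) p hp (λ r r<p → before (suc r) (s≤s r<p))) (sym (at-rest W p))

starOfFirstDes-true : ∀ b D W → starOfFirstDes b D W ≡ true →
  (Σ ℕ λ p → at D p ≡ true × (∀ r → r < p → at D r ≡ false) × at W p ≡ true)
  ⊎ ((∀ r → at D r ≡ false) × b ≡ true)
starOfFirstDes-true b [] W h = inj₂ ((λ r → refl) , h)
starOfFirstDes-true b (true ∷ D) W h = inj₁ (0 , refl , (λ r ()) , trans (at-zero W) h)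
starOfFirstDes-true b (false ∷ D) W h with starOfFirstDes-true b D (rest W) h
... | inj₁ (p , dp , before , wp) = inj₁ (suc p , dp , before′ , trans (at-rest W p) wp)
  where
  before′ : ∀ r → r < suc p → at (false ∷ D) r ≡ false
  before′ zero _ = refl
  before′ (suc r) (s≤s r<p) = before r r<p
... | inj₂ (none , b≡true) = inj₂ (none′ , b≡true)
  where
  none′ : ∀ r → at (false ∷ D) r ≡ false
  none′ zero = refl
  none′ (suc r) = none r

DesFreeBetween : List Bool → ℕ → ℕ → Set
DesFreeBetween D q p = ∀ r → q < r → r < p → at D r ≡ false

prevDes-unique : ∀ D q p → at D q ≡ true → q < p → DesFreeBetween D q p → prevDes D p ≡ q
prevDes-unique D q (suc p) dq (s≤s q≤p) free with ℕₚ.m≤n⇒m<n∨m≡n q≤p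
... | inj₂ refl = if-true q (prevDes D q) dq
... | inj₁ q<p = trans (if-false p (prevDes D p) (free p q<p (ℕₚ.n<1+n p)))
                       (prevDes-unique D q p dq q<p (λ r q<r r<p → free r q<r (ℕₚ.m<n⇒m<1+n r<p)))

prevDes-isDes : ∀ D h p → at D h ≡ true → h < p →
  at D (prevDes D p) ≡ true × prevDes D p < p × DesFreeBetween D (prevDes D p) p
prevDes-isDes D h (suc p) dh (s≤s h≤p) with at D p in dp
... | true = dp , ℕₚ.n<1+n p , λ r p<r r<1+p → ⊥-elim (ℕₚ.<-irrefl refl (ℕₚ.<-≤-trans p<r (ℕₚ.≤-pred r<1+p)))
... | false with ℕₚ.m≤n⇒m<n∨m≡n h≤p
...   | inj₂ refl with () ← trans (sym dh) dp
...   | inj₁ h<p with prevDes-isDes D h p dh h<p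
...     | isDes , below , free = isDes , ℕₚ.m<n⇒m<1+n below , free′
  where
  free′ : DesFreeBetween D (prevDes D p) (suc p)
  free′ r below<r (s≤s r≤p) with ℕₚ.m≤n⇒m<n∨m≡n r≤p
  ... | inj₁ r<p = free r below<r r<p
  ... | inj₂ refl = dp

anyB-≡true⁺ : ∀ f xs p → p ∈ xs → f p ≡ true → anyB f xs ≡ true
anyB-≡true⁺ f (x ∷ xs) p (here refl) fp = cong (_∨ anyB f xs) fp
anyB-≡true⁺ f (x ∷ xs) p (there p∈xs) fp = ∨-≡trueʳ (f x) (anyB-≡true⁺ f xs p p∈xs fp)

anyB-≡true⁻ : ∀ f xs → anyB f xs ≡ true → Σ ℕ λ p → p ∈ xs × f p ≡ true
anyB-≡true⁻ f (x ∷ xs) h with f x in fx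
... | true = x , here refl , fx
... | false with anyB-≡true⁻ f xs h
...   | p , p∈xs , fp = p , there p∈xs , fp

anyB-cong : ∀ f f′ xs → (∀ p → f p ≡ f′ p) → anyB f xs ≡ anyB f′ xs
anyB-cong f f′ [] _ = refl
anyB-cong f f′ (x ∷ xs) h = cong₂ _∨_ (h x) (anyB-cong f f′ xs h)

passStars-at-prevDes : ∀ D W q p → W ⊆ᵇ D → at W p ≡ true → at D q ≡ true → q < p →
  DesFreeBetween D q p → at (passStars true D W) q ≡ true
passStars-at-prevDes D W q p W⊆D wp dq q<p free with <⇒∃-suc-+ q<p
... | c , refl = trans (at-passStars true D W q) (∧-≡true⁺ dq (trans starred (trans (at-drop (suc q) W c) wp)))
  where
  starred : starOfFirstDes true (drop (suc q) D) (drop (suc q) W) ≡ at (drop (suc q) W) c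
  starred = starOfFirstDes-firstDes true (drop (suc q) D) (drop (suc q) W) c
    (trans (at-drop (suc q) D c) (W⊆D _ wp))
    (λ r r<c → trans (at-drop (suc q) D r) (free _ (ℕₚ.m≤m+n (suc q) r) (ℕₚ.+-monoʳ-< (suc q) r<c)))

passStars-at-rightmostDes : ∀ D W h → at D h ≡ true → at (passStars true D W) (rightmostDes D) ≡ true
passStars-at-rightmostDes D W h dh with prevDes-isDes D h (length D) dh (at-true⇒<length D h dh)
... | isDes , _ , free = trans (at-passStars true D W r) (∧-≡true⁺ isDes noneAfter)
  where
  r = rightmostDes D
  noneAfter : starOfFirstDes true (drop (suc r) D) (drop (suc r) W) ≡ true
  noneAfter = starOfFirstDes-noDes true (drop (suc r) D) (drop (suc r) W) λ j → trans (at-drop (suc r) D j) (beyond j)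
    where
    beyond : ∀ j → at D (suc r + j) ≡ false
    beyond j with ℕₚ.<-cmp (suc r + j) (length D)
    ... | tri< lt _ _ = free _ (ℕₚ.m≤m+n (suc r) j) lt
    ... | tri≈ _ eq _ = at-≥length D _ (ℕₚ.≤-reflexive (sym eq))
    ... | tri> _ _ gt = at-≥length D _ (ℕₚ.<⇒≤ gt)

passStars-at-true⁻ : ∀ D W q → q < length D → at (passStars true D W) q ≡ true →
  (Σ ℕ λ p → p < length D × at W p ≡ true × prevDes D p ≡ q) ⊎ rightmostDes D ≡ q
passStars-at-true⁻ D W q q<len h with ∧-≡true⁻ _ _ (trans (sym (at-passStars true D W q)) h)
... | dq , star with starOfFirstDes-true true (drop (suc q) D) (drop (suc q) W) star
...   | inj₁ (c , dc , before , wc) =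
  inj₁ (p , at-true⇒<length D p dp , trans (sym (at-drop (suc q) W c)) wc ,
        prevDes-unique D q p dq (ℕₚ.m≤m+n (suc q) c) free)
  where
  p = suc q + c
  dp = trans (sym (at-drop (suc q) D c)) dc
  free : DesFreeBetween D q p
  free r q<r r<p with <⇒∃-suc-+ q<r
  ... | c′ , refl = trans (sym (at-drop (suc q) D c′)) (before c′ (ℕₚ.+-cancelˡ-< (suc q) c′ c r<p))
...   | inj₂ (none , _) = inj₂ (prevDes-unique D q (length D) dq q<len free)
  where
  free : DesFreeBetween D q (length D)
  free r q<r _ with <⇒∃-suc-+ q<r
  ... | c′ , refl = trans (sym (at-drop (suc q) D c′)) (none c′)

-- The descent left of all stars ensures that prevDes never falls back to its default value 0.
passStars-as-moves : ∀ D W q → q < length D → W ⊆ᵇ D →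
  (Σ ℕ λ h → at D h ≡ true × (∀ p → at W p ≡ true → h < p)) →
  anyB (λ p → at W p ∧ (prevDes D p ≡ᵇ q)) (upTo (length D)) ∨ (q ≡ᵇ rightmostDes D)
    ≡ at (passStars true D W) q
passStars-as-moves D W q q<len W⊆D (h , dh , h<stars) = ≡-from-≡true⇔ _ _ to from
  where
  moved = λ p → at W p ∧ (prevDes D p ≡ᵇ q)
  to : anyB moved (upTo (length D)) ∨ (q ≡ᵇ rightmostDes D) ≡ true → at (passStars true D W) q ≡ true
  to e with ∨-≡true⁻ _ _ e
  ... | inj₂ q≡r = subst (λ z → at (passStars true D W) z ≡ true) (sym (≡ᵇ⇒≡ _ _ q≡r))
                         (passStars-at-rightmostDes D W h dh)
  ... | inj₁ some with anyB-≡true⁻ moved (upTo (length D)) some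
  ...   | p , _ , movedp with ∧-≡true⁻ _ _ movedp
  ...     | wp , prev≡q with prevDes-isDes D h p dh (h<stars p wp)
  ...       | isDes , below , free = subst (λ z → at (passStars true D W) z ≡ true) (≡ᵇ⇒≡ (prevDes D p) q prev≡q)
                                       (passStars-at-prevDes D W (prevDes D p) p W⊆D wp isDes below free)
  from : at (passStars true D W) q ≡ true → anyB moved (upTo (length D)) ∨ (q ≡ᵇ rightmostDes D) ≡ true
  from e with passStars-at-true⁻ D W q q<len e
  ... | inj₁ (p , p<len , wp , refl) =
    cong (_∨ _) (anyB-≡true⁺ moved (upTo (length D)) p (∈ₚ.∈-upTo⁺ p<len) (∧-≡true⁺ wp (≡ᵇ-refl (prevDes D p))))
  ... | inj₂ refl = ∨-≡trueʳ _ (≡ᵇ-refl (rightmostDes D))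

map-upTo-≡ : ∀ (f : ℕ → Bool) N R → length R ≡ N → (∀ q → q < N → f q ≡ at R q) → map f (upTo N) ≡ R
map-upTo-≡ f zero [] _ _ = refl
map-upTo-≡ f (suc N) (r ∷ R) len pointwise = trans (map-upTo-suc f N)
  (cong₂ _∷_ (pointwise 0 (s≤s z≤n))
             (map-upTo-≡ (f ∘ suc) N R (ℕₚ.suc-injective len) (λ q q<N → pointwise (suc q) (s≤s q<N))))

padded-true⁻ : ∀ g ys j → at (replicate g false ++ ys) j ≡ true → Σ ℕ λ r → j ≡ g + r × at ys r ≡ true
padded-true⁻ zero ys j h = j , refl , h
padded-true⁻ (suc g) ys (suc j) h with padded-true⁻ g ys j h
... | r , refl , yr = r , refl , yr

at-padded : ∀ g ys r → at (replicate g false ++ ys) (g + r) ≡ at ys r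
at-padded g ys r = subst (λ z → at (replicate g false ++ ys) (z + r) ≡ at ys r) (Listₚ.length-replicate g)
                         (at-++ʳ (replicate g false) ys r)

-- The star list computed by phi, with the gap g made a parameter.
newStars : ℕ → List Bool → List ℤ → List Bool
newStars g s′ τ = map newStar (upTo (length τ))
  where
  newStar : ℕ → Bool
  newStar q = ((q ≤ᵇ g) ∧ at s′ q)
    ∨ anyB (λ p → (g <ᵇ p) ∧ at s′ p ∧ (prevDes (des τ) p ≡ᵇ q)) (upTo (length τ))
    ∨ (q ≡ᵇ rightmostDes (des τ))

starredInsert : ℤ → ℕ → List ℤ → List ℤ → List Bool → List Bool → List ℤ × List Bool
starredInsert x g πL πR sL sR = πL ++ x ∷ πR , newStars g (sL ++ false ∷ sR) (πL ++ x ∷ πR)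

stars-right-of-gap : ∀ g sL sR p → length sL ≡ g →
  ((g <ᵇ p) ∧ at (sL ++ false ∷ sR) p) ≡ at (replicate g false ++ false ∷ sR) p
stars-right-of-gap g sL sR p len-sL with ℕₚ.<-cmp g p
... | tri< g<p _ _ with <⇒∃-suc-+ g<p
...   | c , refl = trans (cong (_∧ at s′ (suc g + c)) (T⇒≡true (ℕₚ.<⇒<ᵇ g<p)))
                     (trans (subst (λ z → at s′ (suc (z + c)) ≡ at sR c) len-sL (at-++-suc sL false sR c))
                            (sym (trans (cong (at W) (sym (ℕₚ.+-suc g c))) (at-padded g (false ∷ sR) (suc c)))))
  where
  s′ = sL ++ false ∷ sR
  W = replicate g false ++ false ∷ sR
stars-right-of-gap g sL sR p len-sL | tri≈ _ refl _ =
  trans (cong (_∧ at (sL ++ false ∷ sR) g) (¬T⇒≡false (λ t → ℕₚ.<-irrefl refl (ℕₚ.<ᵇ⇒< g g t))))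
        (sym (trans (cong (at (replicate g false ++ false ∷ sR)) (sym (ℕₚ.+-identityʳ g))) (at-padded g (false ∷ sR) 0)))
stars-right-of-gap g sL sR p len-sL | tri> _ _ p<g =
  trans (cong (_∧ at (sL ++ false ∷ sR) p) (¬T⇒≡false (λ t → ℕₚ.<-asym p<g (ℕₚ.<ᵇ⇒< g p t))))
        (sym (trans (at-++ˡ (replicate g false) _ p (subst (p <_) (sym (Listₚ.length-replicate g)) p<g)) (at-replicate g p)))

stars-left-of-gap : ∀ g sL sR G q → length sL ≡ g →
  ((q ≤ᵇ g) ∧ at (sL ++ false ∷ sR) q) ∨ at (replicate g false ++ G) q ≡ at (sL ++ G) q
stars-left-of-gap g sL sR G q len-sL with ℕₚ.<-cmp q g
... | tri< q<g _ _ = trans (cong₂ _∨_ (trans (cong (_∧ at (sL ++ false ∷ sR) q) (T⇒≡true (ℕₚ.≤⇒≤ᵇ (ℕₚ.<⇒≤ q<g))))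
                                              (at-++ˡ sL _ q q<sL))
                                       (trans (at-++ˡ (replicate g false) G q (subst (q <_) (sym (Listₚ.length-replicate g)) q<g))
                                              (at-replicate g q)))
                           (trans (∨-identityʳ (at sL q)) (sym (at-++ˡ sL G q q<sL)))
  where
  q<sL = subst (q <_) (sym len-sL) q<g
... | tri≈ _ refl _ = trans (cong₂ _∨_ (trans (cong (_∧ at (sL ++ false ∷ sR) q) (T⇒≡true (ℕₚ.≤⇒≤ᵇ (ℕₚ.≤-refl {q}))))
                                               (subst (λ z → at (sL ++ false ∷ sR) z ≡ false) len-sL (at-++-length sL (false ∷ sR))))
                                        (trans (cong (at (replicate q false ++ G)) (sym (ℕₚ.+-identityʳ q))) (at-padded q G 0)))
                            (sym (subst (λ z → at (sL ++ G) z ≡ at G 0) len-sL (at-++-length sL G)))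
... | tri> _ _ g<q with <⇒∃-suc-+ g<q
...   | c , refl = trans (cong₂ _∨_ (cong (_∧ at (sL ++ false ∷ sR) (suc g + c)) (¬T⇒≡false (λ t → ℕₚ.<⇒≱ g<q (ℕₚ.≤ᵇ⇒≤ _ g t))))
                                    (trans (cong (at (replicate g false ++ G)) (sym (ℕₚ.+-suc g c))) (at-padded g G (suc c))))
                         (sym (subst (λ z → at (sL ++ G) (suc (z + c)) ≡ at G (suc c)) len-sL
                                     (trans (cong (at (sL ++ G)) (sym (ℕₚ.+-suc (length sL) c))) (at-++ʳ sL G (suc c)))))

newStars-split : ∀ g dL X sL sR τ → des τ ≡ dL ++ X → length dL ≡ g → length sL ≡ g →
  (false ∷ sR) ⊆ᵇ X → (Σ ℕ λ h → at X h ≡ true × (∀ p → at (false ∷ sR) p ≡ true → h < p)) →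
  starOfFirstDes true X (false ∷ sR) ≡ false →
  newStars g (sL ++ false ∷ sR) τ ≡ sL ++ passStars true X (false ∷ sR)
newStars-split g dL X sL sR τ dτ≡ len-dL len-sL sR⊆X (h , xh , h<stars) firstStar≡false =
  map-upTo-≡ _ (length τ) (sL ++ G) len-result pointwise
  where
  s′ = sL ++ false ∷ sR
  D = dL ++ X
  W = replicate g false ++ false ∷ sR
  G = passStars true X (false ∷ sR)
  len-τ : length τ ≡ length D
  len-τ = trans (sym (length-desAux (+ 0) τ)) (cong length dτ≡)
  len-result : length (sL ++ G) ≡ length τ
  len-result = trans (Listₚ.length-++ sL) (trans (cong₂ _+_ (trans len-sL (sym len-dL)) (length-passStars true X (false ∷ sR)))
                 (trans (sym (Listₚ.length-++ dL)) (sym len-τ)))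
  W⊆D : W ⊆ᵇ D
  W⊆D j wj with padded-true⁻ g (false ∷ sR) j wj
  ... | r , refl , sr = subst (λ z → at D (z + r) ≡ true) len-dL (trans (at-++ʳ dL X r) (sR⊆X r sr))
  desBeforeStars : Σ ℕ λ h′ → at D h′ ≡ true × (∀ p → at W p ≡ true → h′ < p)
  desBeforeStars = g + h , subst (λ z → at D (z + h) ≡ true) len-dL (trans (at-++ʳ dL X h) xh) , after
    where
    after : ∀ p → at W p ≡ true → g + h < p
    after p wp with padded-true⁻ g (false ∷ sR) p wp
    ... | r , refl , sr = ℕₚ.+-monoʳ-< g (h<stars r sr)
  passStars-padded : passStars true D W ≡ replicate g false ++ G
  passStars-padded = subst (λ z → passStars true D (replicate z false ++ false ∷ sR) ≡ replicate z false ++ G) len-dL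
                           (passStars-unstarred-++ true dL X (false ∷ sR) firstStar≡false)
  movedStars : ∀ q → q < length τ →
    anyB (λ p → (g <ᵇ p) ∧ at s′ p ∧ (prevDes (des τ) p ≡ᵇ q)) (upTo (length τ)) ∨ (q ≡ᵇ rightmostDes (des τ))
      ≡ at (replicate g false ++ G) q
  movedStars q q<N = begin
    anyB (λ p → (g <ᵇ p) ∧ at s′ p ∧ (prevDes (des τ) p ≡ᵇ q)) (upTo (length τ)) ∨ (q ≡ᵇ rightmostDes (des τ))
      ≡⟨ cong₂ (λ D′ N → anyB (λ p → (g <ᵇ p) ∧ at s′ p ∧ (prevDes D′ p ≡ᵇ q)) (upTo N) ∨ (q ≡ᵇ rightmostDes D′)) dτ≡ len-τ ⟩
    anyB (λ p → (g <ᵇ p) ∧ at s′ p ∧ (prevDes D p ≡ᵇ q)) (upTo (length D)) ∨ (q ≡ᵇ rightmostDes D)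
      ≡⟨ cong (_∨ (q ≡ᵇ rightmostDes D)) (anyB-cong _ _ (upTo (length D))
           (λ p → trans (sym (∧-assoc (g <ᵇ p) (at s′ p) _)) (cong (_∧ (prevDes D p ≡ᵇ q)) (stars-right-of-gap g sL sR p len-sL)))) ⟩
    anyB (λ p → at W p ∧ (prevDes D p ≡ᵇ q)) (upTo (length D)) ∨ (q ≡ᵇ rightmostDes D)
      ≡⟨ passStars-as-moves D W q (subst (q <_) len-τ q<N) W⊆D desBeforeStars ⟩
    at (passStars true D W) q
      ≡⟨ cong (λ l → at l q) passStars-padded ⟩
    at (replicate g false ++ G) q ∎
    where open ≡-Reasoning
  pointwise : ∀ q → q < length τ → _ ≡ at (sL ++ G) q
  pointwise q q<N = trans (cong (((q ≤ᵇ g) ∧ at s′ q) ∨_) (movedStars q q<N)) (stars-left-of-gap g sL sR G q len-sL)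

countTrue-flip : ∀ u D → countTrue (u ∷ not u ∷ D) ≡ suc (countTrue D)
countTrue-flip true D = refl
countTrue-flip false D = refl

sumMaj-flip : ∀ o u D → sumMaj o (u ∷ not u ∷ D) + 2 * bit u ≡ 2 * suc o + sumMaj (suc o) D + 2 * countTrue D
sumMaj-flip o true D = trans (cong (λ z → 2 * o + z + 2) (sumMaj-suc (suc o) D)) (shuffle o (sumMaj (suc o) D) (countTrue D))
  where
  shuffle : ∀ o m c → 2 * o + (m + 2 * c) + 2 ≡ 2 * suc o + m + 2 * c
  shuffle = ℕSolver.solve-∀
sumMaj-flip o false D =
  trans (ℕₚ.+-identityʳ _) (trans (cong (λ z → 2 * suc o + z) (sumMaj-suc (suc o) D)) (sym (ℕₚ.+-assoc (2 * suc o) _ _)))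

starOfFirstDes-flip : ∀ u D W → starOfFirstDes true (u ∷ not u ∷ D) (false ∷ false ∷ W) ≡ false
starOfFirstDes-flip true D W = refl
starOfFirstDes-flip false D W = refl

countTrue-passStars-flip : ∀ u D W → W ⊆ᵇ D →
  countTrue (passStars true (u ∷ not u ∷ D) (false ∷ false ∷ W)) ≡ countTrue W + 1
countTrue-passStars-flip true D W W⊆D =
  trans (countTrue-∷ (starOfFirstDes true D W) (false ∷ passStars true D W))
        (trans (ℕₚ.+-comm _ (countTrue (passStars true D W))) (countTrue-passStars true D W W⊆D))
countTrue-passStars-flip false D W W⊆D =
  trans (countTrue-∷ (starOfFirstDes true D W) (passStars true D W))
        (trans (ℕₚ.+-comm _ (countTrue (passStars true D W))) (countTrue-passStars true D W W⊆D))

starCost-passStars-flip : ∀ u D W → W ⊆ᵇ D →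
  starCost (u ∷ not u ∷ D) (passStars true (u ∷ not u ∷ D) (false ∷ false ∷ W)) ≡ starCost D W + 2 * countTrue W + 2
starCost-passStars-flip true D W W⊆D =
  trans (ℕₚ.+-comm _ (starCost D (passStars true D W))) (starCost-passStars true D W W⊆D)
starCost-passStars-flip false D W W⊆D =
  trans (ℕₚ.+-comm _ (starCost D (passStars true D W))) (starCost-passStars true D W W⊆D)

<?-extreme : ∀ x a → ∣ a ∣ < ∣ x ∣ → does (x ℤ.<? a) ≡ isNeg x × does (a ℤ.<? x) ≡ not (isNeg x)
<?-extreme (+ n) a a<n = dec-false (+ n ℤ.<? a) (n≮a a a<n) , dec-true (a ℤ.<? + n) (a<n′ a a<n)
  where
  n≮a : ∀ a → ∣ a ∣ < n → + n ℤ.< a → ⊥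
  n≮a (+ p) p<n (+<+ n<p) = ℕₚ.<-asym p<n n<p
  a<n′ : ∀ a → ∣ a ∣ < n → a ℤ.< + n
  a<n′ (+ p) p<n = +<+ p<n
  a<n′ -[1+ p ] _ = -<+
<?-extreme -[1+ n ] a a<n = dec-true (-[1+ n ] ℤ.<? a) (−n<a a a<n) , dec-false (a ℤ.<? -[1+ n ]) (a≮−n a a<n)
  where
  −n<a : ∀ a → ∣ a ∣ < suc n → -[1+ n ] ℤ.< a
  −n<a (+ p) _ = -<+
  −n<a -[1+ p ] (s≤s p<n) = -<- p<n
  a≮−n : ∀ a → ∣ a ∣ < suc n → a ℤ.< -[1+ n ] → ⊥
  a≮−n -[1+ p ] (s≤s p<n) (-<- n<p) = ℕₚ.<-asym p<n n<p

lastOr-All : ∀ (P : ℤ → Set) a xs → P a → (∀ y → y ∈ xs → P y) → P (lastOr a xs)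
lastOr-All P a [] pa _ = pa
lastOr-All P a (x ∷ xs) _ h = lastOr-All P x xs (h x (here refl)) (λ y y∈xs → h y (there y∈xs))

-- Around the inserted letter the descent bits are u ∷ not u with u = [x < 0], and the stars to its right are passed
-- one descent to the left.
fmajS-insert-split : ∀ πL b πR x sL W → length sL ≡ length πL → W ⊆ᵇ desAux b πR →
  does (x ℤ.<? lastOr (+ 0) πL) ≡ isNeg x → does (b ℤ.<? x) ≡ not (isNeg x) →
  let g = length πL
      e = does (b ℤ.<? lastOr (+ 0) πL)
      π = πL ++ b ∷ πR
      s = sL ++ false ∷ W
      p′ = starredInsert x g πL (b ∷ πR) sL (false ∷ W)
  in fmajS⁺ p′ + fmajS⁻ (π , s) + (2 * (if e then g else countTrue sL) + 2 * countTrue W + 1) + bit (isNeg x)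
       ≡ fmajS⁺ (π , s) + fmajS⁻ p′ + 2 * suc (g + countTrue (desAux b πR))
fmajS-insert-split πL b πR x sL W len-sL W⊆D x<last b<x =
  begin
    fmajS⁺ (τ , t) + fmajS⁻ (π , s) + M + bit u
      ≡⟨ cong (λ t′ → fmajS⁺ (τ , t′) + fmajS⁻ (π , s) + M + bit u) t≡ ⟩
    fmajS⁺ (τ , sL ++ G) + fmajS⁻ (π , s) + M + bit u
      ≡⟨ cong₂ (λ a b′ → a + b′ + M + bit u) F₁ K₀ ⟩
    A + (sumMaj g X + (bit u + neg (b ∷ πR)) + (countTrue W + 1)) + (KL + 2 * ((bit e + cD) * cL) + starCost D W) + M + bit u
      ≡⟨ arith ⟩
    A + (bit e * (2 * g) + sumMaj (suc g) D + neg (b ∷ πR) + countTrue W)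
      + (KL + 2 * (suc cD * cL) + (starCost D W + 2 * countTrue W + 2)) + 2 * suc (g + cD)
      ≡⟨ cong₂ (λ a b′ → a + b′ + 2 * suc (g + cD)) (sym F₀) (sym K₁) ⟩
    fmajS⁺ (π , s) + fmajS⁻ (τ , sL ++ G) + 2 * suc (g + cD)
      ≡⟨ cong (λ t′ → fmajS⁺ (π , s) + fmajS⁻ (τ , t′) + 2 * suc (g + cD)) (sym t≡) ⟩
    fmajS⁺ (π , s) + fmajS⁻ (τ , t) + 2 * suc (g + cD) ∎
  where
  open ≡-Reasoning
  g = length πL
  a = lastOr (+ 0) πL
  e = does (b ℤ.<? a)
  u = isNeg x
  D = desAux b πR
  X = u ∷ not u ∷ D
  π = πL ++ b ∷ πR
  s = sL ++ false ∷ W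
  τ = πL ++ x ∷ b ∷ πR
  t = newStars g (sL ++ false ∷ false ∷ W) τ
  G = passStars true X (false ∷ false ∷ W)
  A = fmajS⁺ (πL , sL)
  KL = fmajS⁻ (πL , sL)
  cL = countTrue sL
  cD = countTrue D
  M = 2 * (if e then g else cL) + 2 * countTrue W + 1
  around-x : desAux a (x ∷ b ∷ πR) ≡ X
  around-x = cong₂ (λ p q → p ∷ q ∷ D) x<last b<x
  t≡ : t ≡ sL ++ G
  t≡ = newStars-split g (des πL) X sL (false ∷ W) τ
         (trans (desAux-++ (+ 0) πL (x ∷ b ∷ πR)) (cong (des πL ++_) around-x))
         (length-desAux (+ 0) πL) len-sL stars⊆X descent-first (starOfFirstDes-flip u D W)
    where
    stars⊆X : (false ∷ false ∷ W) ⊆ᵇ X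
    stars⊆X (suc (suc j)) w = W⊆D j w
    descent-first : Σ ℕ λ h → at X h ≡ true × (∀ p → at (false ∷ false ∷ W) p ≡ true → h < p)
    descent-first with u
    ... | true = 0 , refl , λ { (suc (suc p)) _ → s≤s z≤n }
    ... | false = 1 , refl , λ { (suc (suc p)) _ → s≤s (s≤s z≤n) }
  F₁ : fmajS⁺ (τ , sL ++ G) ≡ A + (sumMaj g X + (bit u + neg (b ∷ πR)) + (countTrue W + 1))
  F₁ = trans (fmajS⁺-++ πL (x ∷ b ∷ πR) sL G)
             (cong (λ z → A + z) (cong₃ (λ d n c → sumMaj g d + n + c) around-x (neg-∷ x (b ∷ πR))
                                        (countTrue-passStars-flip u D W W⊆D)))
  K₁ : fmajS⁻ (τ , sL ++ G) ≡ KL + 2 * (suc cD * cL) + (starCost D W + 2 * countTrue W + 2)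
  K₁ = trans (fmajS⁻-++ πL (x ∷ b ∷ πR) sL G len-sL)
             (trans (cong (λ d → KL + 2 * (countTrue d * cL) + starCost d G) around-x)
                    (cong₂ (λ c q → KL + 2 * (c * cL) + q) (countTrue-flip u D) (starCost-passStars-flip u D W W⊆D)))
  F₀ : fmajS⁺ (π , s) ≡ A + (bit e * (2 * g) + sumMaj (suc g) D + neg (b ∷ πR) + countTrue W)
  F₀ = trans (fmajS⁺-++ πL (b ∷ πR) sL (false ∷ W))
             (cong (λ m → A + (m + neg (b ∷ πR) + countTrue W)) (sumMaj-∷ g e D))
  K₀ : fmajS⁻ (π , s) ≡ KL + 2 * ((bit e + cD) * cL) + starCost D W
  K₀ = trans (fmajS⁻-++ πL (b ∷ πR) sL (false ∷ W) len-sL)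
             (cong (λ c → KL + 2 * (c * cL) + starCost D W) (countTrue-∷ e D))
  R = A + neg (b ∷ πR) + countTrue W + KL + 2 * (cD * cL) + starCost D W + 2 * countTrue W + 2
  arith : A + (sumMaj g X + (bit u + neg (b ∷ πR)) + (countTrue W + 1))
            + (KL + 2 * ((bit e + cD) * cL) + starCost D W) + M + bit u
          ≡ A + (bit e * (2 * g) + sumMaj (suc g) D + neg (b ∷ πR) + countTrue W)
            + (KL + 2 * (suc cD * cL) + (starCost D W + 2 * countTrue W + 2)) + 2 * suc (g + cD)
  arith = begin
    _ ≡⟨ gather (sumMaj g X) (bit u) A (neg (b ∷ πR)) (countTrue W) KL (bit e) cD cL (starCost D W) (if e then g else cL) ⟩
    (sumMaj g X + 2 * bit u) + (2 * (if e then g else cL) + 2 * (bit e * cL)) + R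
      ≡⟨ cong₂ (λ y z → y + z + R) (sumMaj-flip g u D) (if-weight e g cL) ⟩
    (2 * suc g + sumMaj (suc g) D + 2 * cD) + (bit e * (2 * g) + 2 * cL) + R
      ≡⟨ spread g (sumMaj (suc g) D) cD A (neg (b ∷ πR)) (countTrue W) KL cL (starCost D W) (bit e * (2 * g)) ⟩
    _ ∎
    where
    if-weight : ∀ e g l → 2 * (if e then g else l) + 2 * (bit e * l) ≡ bit e * (2 * g) + 2 * l
    if-weight true g l = cong₂ (λ x y → x + 2 * y) (sym (ℕₚ.*-identityˡ (2 * g))) (ℕₚ.*-identityˡ l)
    if-weight false g l = ℕₚ.+-identityʳ (2 * l)
    gather : ∀ sX u A n w K E c l q I → A + (sX + (u + n) + (w + 1)) + (K + 2 * ((E + c) * l) + q) + (2 * I + 2 * w + 1) + u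
               ≡ (sX + 2 * u) + (2 * I + 2 * (E * l)) + (A + n + w + K + 2 * (c * l) + q + 2 * w + 2)
    gather = ℕSolver.solve-∀
    spread : ∀ g m c A n w K l q EG → (2 * suc g + m + 2 * c) + (EG + 2 * l) + (A + n + w + K + 2 * (c * l) + q + 2 * w + 2)
               ≡ A + (EG + m + n + w) + (K + 2 * (suc c * l) + (q + 2 * w + 2)) + 2 * suc (g + c)
    spread = ℕSolver.solve-∀

insertAt : ℤ → ℕ → List ℤ × List Bool → List ℤ × List Bool
insertAt x g (π , s) = starredInsert x g (take g π) (drop g π) (take g s) (drop g s)

phi-at-gap : ∀ x i π s g → gapOf π s i ≡ g → phi x i (π , s) ≡ insertAt x g (π , s)
phi-at-gap x i π s g refl = refl

gapWeight : List Bool → List Bool → ℕ → ℕ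
gapWeight d s g = 2 * (if at d g then g else countTrue (take g s)) + 2 * countTrue (drop (suc g) s) + 1

drop-∷ : ∀ {A : Set} g (l : List A) → g < length l → Σ A λ b → drop g l ≡ b ∷ drop (suc g) l
drop-∷ zero (x ∷ l) _ = x , refl
drop-∷ (suc g) (x ∷ l) (s≤s g<) = drop-∷ g l g<

length-take-≤ : ∀ {A : Set} g (l : List A) → g ≤ length l → length (take g l) ≡ g
length-take-≤ g l g≤ = trans (Listₚ.length-take g l) (ℕₚ.m≤n⇒m⊓n≡m g≤)

drop-suc-length : ∀ xs (e : Bool) ys → drop (suc (length xs)) (xs ++ e ∷ ys) ≡ ys
drop-suc-length [] e ys = refl
drop-suc-length (x ∷ xs) e ys = drop-suc-length xs e ys

fmajS-insert : ∀ x π s g → (∀ a → a ∈ π → ∣ a ∣ < ∣ x ∣) → 0 < ∣ x ∣ →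
  length s ≡ length π → s ⊆ᵇ des π → g < length π → at s g ≡ false →
  fmajS⁺ (insertAt x g (π , s)) + fmajS⁻ (π , s) + gapWeight (des π) s g + bit (isNeg x)
    ≡ fmajS⁺ (π , s) + fmajS⁻ (insertAt x g (π , s)) + 2 * suc (g + countTrue (drop (suc g) (des π)))
fmajS-insert x π s g small 0<x ls s⊆d g<π sg = begin
  fmajS⁺ (insertAt x g (π , s)) + fmajS⁻ (π , s) + gapWeight (des π) s g + bit (isNeg x)
    ≡⟨ cong₃ (λ p q w → fmajS⁺ p + fmajS⁻ q + w + bit (isNeg x)) inserted (sym split) weight ⟩
  fmajS⁺ p′ + fmajS⁻ (πL ++ b ∷ πR , sL ++ false ∷ W) + (2 * (if e then length πL else countTrue sL) + 2 * countTrue W + 1) + bit (isNeg x)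
    ≡⟨ fmajS-insert-split πL b πR x sL W len-sL W⊆D x<last b<x ⟩
  fmajS⁺ (πL ++ b ∷ πR , sL ++ false ∷ W) + fmajS⁻ p′ + 2 * suc (length πL + countTrue D)
    ≡⟨ cong₃ (λ q p c → fmajS⁺ q + fmajS⁻ p + 2 * suc c) split (sym inserted) (cong₂ _+_ len-πL tail-descents) ⟩
  fmajS⁺ (π , s) + fmajS⁻ (insertAt x g (π , s)) + 2 * suc (g + countTrue (drop (suc g) (des π))) ∎
  where
  open ≡-Reasoning
  b = proj₁ (drop-∷ g π g<π)
  πL = take g π
  πR = drop (suc g) π
  sL = take g s
  W = drop (suc g) s
  D = desAux b πR
  e = does (b ℤ.<? lastOr (+ 0) πL)
  p′ = starredInsert x (length πL) πL (b ∷ πR) sL (false ∷ W)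
  g<s : g < length s
  g<s = subst (g <_) (sym ls) g<π
  len-πL : length πL ≡ g
  len-πL = length-take-≤ g π (ℕₚ.<⇒≤ g<π)
  len-sL : length sL ≡ length πL
  len-sL = trans (length-take-≤ g s (ℕₚ.<⇒≤ g<s)) (sym len-πL)
  drop-π : drop g π ≡ b ∷ πR
  drop-π = proj₂ (drop-∷ g π g<π)
  drop-s : drop g s ≡ false ∷ W
  drop-s = trans (drop-at g s g<s) (cong (_∷ W) sg)
  split : (πL ++ b ∷ πR , sL ++ false ∷ W) ≡ (π , s)
  split = cong₂ _,_ (trans (cong (πL ++_) (sym drop-π)) (Listₚ.take++drop≡id g π))
                    (trans (cong (sL ++_) (sym drop-s)) (Listₚ.take++drop≡id g s))
  inserted : insertAt x g (π , s) ≡ p′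
  inserted = cong₃ (λ g′ r w → starredInsert x g′ πL r sL w) (sym len-πL) drop-π drop-s
  des-split : des π ≡ des πL ++ e ∷ D
  des-split = trans (cong (des ∘ proj₁) (sym split)) (desAux-++ (+ 0) πL (b ∷ πR))
  len-dL : length (des πL) ≡ g
  len-dL = trans (length-desAux (+ 0) πL) len-πL
  e≡ : at (des π) g ≡ e
  e≡ = trans (cong (λ d → at d g) des-split) (subst (λ z → at (des πL ++ e ∷ D) z ≡ e) len-dL (at-++-length (des πL) (e ∷ D)))
  tail-descents : countTrue D ≡ countTrue (drop (suc g) (des π))
  tail-descents = cong countTrue (sym (trans (cong (drop (suc g)) des-split)
                    (subst (λ z → drop (suc z) (des πL ++ e ∷ D) ≡ D) len-dL (drop-suc-length (des πL) e D))))
  weight : gapWeight (des π) s g ≡ 2 * (if e then length πL else countTrue sL) + 2 * countTrue W + 1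
  weight = cong₂ (λ e′ g′ → 2 * (if e′ then g′ else countTrue sL) + 2 * countTrue W + 1) e≡ (sym len-πL)
  W⊆D : W ⊆ᵇ D
  W⊆D j w = trans (sym (at-++-suc (des πL) e D j))
    (trans (cong (λ d → at d (suc (length (des πL) + j))) (sym des-split))
      (s⊆d _ (trans (cong (λ z → at s (suc (z + j))) len-dL) (trans (sym (at-drop (suc g) s j)) w))))
  b∈π : b ∈ π
  b∈π = subst (b ∈_) (Listₚ.take++drop≡id g π) (∈ₚ.∈-++⁺ʳ πL (subst (b ∈_) (sym drop-π) (here refl)))
  x<last : does (x ℤ.<? lastOr (+ 0) πL) ≡ isNeg x
  x<last = proj₁ (<?-extreme x _ (lastOr-All (λ a → ∣ a ∣ < ∣ x ∣) (+ 0) πL 0<x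
                    (λ y y∈ → small y (subst (y ∈_) (Listₚ.take++drop≡id g π) (∈ₚ.∈-++⁺ˡ y∈)))))
  b<x : does (b ℤ.<? x) ≡ not (isNeg x)
  b<x = proj₂ (<?-extreme x b (small b b∈π))

fmajS-insert-end : ∀ x π s → does (x ℤ.<? lastOr (+ 0) π) ≡ true → length s ≡ length π →
  fmajS⁺ (insertAt x (length π) (π , s)) + fmajS⁻ (π , s) + (2 * countTrue s + 1)
    ≡ fmajS⁺ (π , s) + fmajS⁻ (insertAt x (length π) (π , s)) + (2 * length π + bit (isNeg x))
fmajS-insert-end x π s x<last ls = begin
  fmajS⁺ (insertAt x m (π , s)) + fmajS⁻ (π , s) + (2 * countTrue s + 1)
    ≡⟨ cong (λ p → fmajS⁺ p + fmajS⁻ (π , s) + (2 * countTrue s + 1)) inserted ⟩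
  fmajS⁺ (π ++ x ∷ [] , s ++ true ∷ []) + fmajS⁻ (π , s) + (2 * countTrue s + 1)
    ≡⟨ cong (λ f → f + fmajS⁻ (π , s) + (2 * countTrue s + 1)) F₁ ⟩
  fmajS⁺ (π , s) + (2 * m + 0 + (bit (isNeg x) + 0) + 1) + fmajS⁻ (π , s) + (2 * countTrue s + 1)
    ≡⟨ shuffle (fmajS⁺ (π , s)) (fmajS⁻ (π , s)) m (bit (isNeg x)) (countTrue s) ⟩
  fmajS⁺ (π , s) + (fmajS⁻ (π , s) + 2 * (1 * countTrue s) + (1 * 2 + 0)) + (2 * m + bit (isNeg x))
    ≡⟨ cong (λ k → fmajS⁺ (π , s) + k + (2 * m + bit (isNeg x))) (sym K₁) ⟩
  fmajS⁺ (π , s) + fmajS⁻ (π ++ x ∷ [] , s ++ true ∷ []) + (2 * m + bit (isNeg x))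
    ≡⟨ cong (λ p → fmajS⁺ (π , s) + fmajS⁻ p + (2 * m + bit (isNeg x))) (sym inserted) ⟩
  fmajS⁺ (π , s) + fmajS⁻ (insertAt x m (π , s)) + (2 * m + bit (isNeg x)) ∎
  where
  open ≡-Reasoning
  m = length π
  last-descent : desAux (lastOr (+ 0) π) (x ∷ []) ≡ true ∷ []
  last-descent = cong (_∷ []) x<last
  stars : newStars m (s ++ false ∷ []) (π ++ x ∷ []) ≡ s ++ true ∷ []
  stars = newStars-split m (des π) (true ∷ []) s [] (π ++ x ∷ [])
            (trans (desAux-++ (+ 0) π (x ∷ [])) (cong (des π ++_) last-descent))
            (length-desAux (+ 0) π) ls (λ { zero () ; (suc j) () }) (0 , refl , λ { zero () ; (suc p) () }) refl
  inserted : insertAt x m (π , s) ≡ (π ++ x ∷ [] , s ++ true ∷ [])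
  inserted = trans (cong₂ (λ πL sL → starredInsert x m πL (drop m π) sL (drop m s))
                          (Listₚ.take-all m π ℕₚ.≤-refl) (Listₚ.take-all m s (ℕₚ.≤-reflexive ls)))
             (trans (cong₂ (λ πR sR → starredInsert x m π πR s sR)
                           (Listₚ.drop-all m π ℕₚ.≤-refl) (Listₚ.drop-all m s (ℕₚ.≤-reflexive ls)))
                    (cong (π ++ x ∷ [] ,_) stars))
  F₁ : fmajS⁺ (π ++ x ∷ [] , s ++ true ∷ []) ≡ fmajS⁺ (π , s) + (2 * m + 0 + (bit (isNeg x) + 0) + 1)
  F₁ = trans (fmajS⁺-++ π (x ∷ []) s (true ∷ []))
             (cong₂ (λ d n → fmajS⁺ (π , s) + (sumMaj m d + n + 1)) last-descent (neg-∷ x []))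
  K₁ : fmajS⁻ (π ++ x ∷ [] , s ++ true ∷ []) ≡ fmajS⁻ (π , s) + 2 * (1 * countTrue s) + (1 * 2 + 0)
  K₁ = trans (fmajS⁻-++ π (x ∷ []) s (true ∷ []) ls)
             (cong (λ d → fmajS⁻ (π , s) + 2 * (countTrue d * countTrue s) + starCost d (true ∷ [])) last-descent)
  shuffle : ∀ F K m u c → F + (2 * m + 0 + (u + 0) + 1) + K + (2 * c + 1) ≡ F + (K + 2 * (1 * c) + (1 * 2 + 0)) + (2 * m + u)
  shuffle = ℕSolver.solve-∀

countBelow : (ℕ → Bool) → ℕ → ℕ
countBelow P zero = 0
countBelow P (suc r) = countBelow P r + bit (P r)

filterB-++ : ∀ P xs ys → filterB P (xs ++ ys) ≡ filterB P xs ++ filterB P ys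
filterB-++ P [] ys = refl
filterB-++ P (x ∷ xs) ys with P x
... | true = cong (x ∷_) (filterB-++ P xs ys)
... | false = filterB-++ P xs ys

filterB-upTo-suc : ∀ P M → filterB P (upTo (suc M)) ≡ (if P M then filterB P (upTo M) ++ M ∷ [] else filterB P (upTo M))
filterB-upTo-suc P M = trans (cong (filterB P) (sym (Listₚ.upTo-∷ʳ M))) (trans (filterB-++ P (upTo M) (M ∷ [])) (last P M))
  where
  last : ∀ P M → filterB P (upTo M) ++ filterB P (M ∷ []) ≡ (if P M then filterB P (upTo M) ++ M ∷ [] else filterB P (upTo M))
  last P M with P M
  ... | true = refl
  ... | false = Listₚ.++-identityʳ _

length-filterB-upTo : ∀ P M → length (filterB P (upTo M)) ≡ countBelow P M
length-filterB-upTo P zero = refl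
length-filterB-upTo P (suc M) rewrite filterB-upTo-suc P M with P M
... | true = trans (Listₚ.length-++ (filterB P (upTo M))) (cong (_+ 1) (length-filterB-upTo P M))
... | false = trans (length-filterB-upTo P M) (sym (ℕₚ.+-identityʳ _))

nthOr-++ˡ : ∀ d xs ys j → j < length xs → nthOr d (xs ++ ys) j ≡ nthOr d xs j
nthOr-++ˡ d (x ∷ xs) ys zero _ = refl
nthOr-++ˡ d (x ∷ xs) ys (suc j) (s≤s j<) = nthOr-++ˡ d xs ys j j<

nthOr-++ʳ : ∀ d xs ys r → nthOr d (xs ++ ys) (length xs + r) ≡ nthOr d ys r
nthOr-++ʳ d [] ys r = refl
nthOr-++ʳ d (x ∷ xs) ys r = nthOr-++ʳ d xs ys r

nthOr-++-length : ∀ d xs y ys → nthOr d (xs ++ y ∷ ys) (length xs) ≡ y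
nthOr-++-length d [] y ys = refl
nthOr-++-length d (x ∷ xs) y ys = nthOr-++-length d xs y ys

nthOr-reverse : ∀ d xs j → j < length xs → nthOr d (reverse xs) j ≡ nthOr d xs (length xs ∸ suc j)
nthOr-reverse d (x ∷ xs) j j< rewrite Listₚ.unfold-reverse x xs with ℕₚ.m≤n⇒m<n∨m≡n (ℕₚ.≤-pred j<)
... | inj₁ j<xs = trans (nthOr-++ˡ d (reverse xs) (x ∷ []) j (subst (j <_) (sym (Listₚ.length-reverse xs)) j<xs))
                        (trans (nthOr-reverse d xs j j<xs) (cong (nthOr d (x ∷ xs)) (sym (ℕₚ.+-∸-assoc 1 j<xs))))
... | inj₂ refl = trans (subst (λ z → nthOr d (reverse xs ++ x ∷ []) z ≡ x) (Listₚ.length-reverse xs)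
                               (nthOr-++-length d (reverse xs) x []))
                        (cong (nthOr d (x ∷ xs)) (sym (ℕₚ.n∸n≡0 (length xs))))

nthOr-filterB-upTo : ∀ P M j → j < length (filterB P (upTo M)) →
  Σ ℕ λ g → nthOr 0 (filterB P (upTo M)) j ≡ g × g < M × P g ≡ true × countBelow P g ≡ j
nthOr-filterB-upTo P (suc M) j j< rewrite filterB-upTo-suc P M with P M in PM
... | false with nthOr-filterB-upTo P M j j<
...   | g , nth , g<M , Pg , below = g , nth , ℕₚ.m<n⇒m<1+n g<M , Pg , below
nthOr-filterB-upTo P (suc M) j j< | true with ℕₚ.<-cmp j (length (filterB P (upTo M)))
... | tri< j<F _ _ with nthOr-filterB-upTo P M j j<F
...   | g , nth , g<M , Pg , below = g , trans (nthOr-++ˡ 0 (filterB P (upTo M)) (M ∷ []) j j<F) nth , ℕₚ.m<n⇒m<1+n g<M , Pg , below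
nthOr-filterB-upTo P (suc M) j j< | true | tri≈ _ refl _ =
  M , nthOr-++-length 0 (filterB P (upTo M)) M [] ,
  ℕₚ.n<1+n M , PM , sym (length-filterB-upTo P M)
nthOr-filterB-upTo P (suc M) j j< | true | tri> _ _ F<j =
  ⊥-elim (ℕₚ.<-irrefl refl (ℕₚ.<-≤-trans F<j (ℕₚ.≤-pred (subst (j <_) (trans (Listₚ.length-++ (filterB P (upTo M))) (ℕₚ.+-comm _ 1)) j<))))

countBelow-suc : ∀ P r → countBelow P (suc r) ≡ bit (P 0) + countBelow (P ∘ suc) r
countBelow-suc P zero = ℕₚ.+-comm 0 (bit (P 0))
countBelow-suc P (suc r) = trans (cong (_+ bit (P (suc r))) (countBelow-suc P r)) (ℕₚ.+-assoc (bit (P 0)) _ _)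

countBelow-false : ∀ r → countBelow (λ _ → false) r ≡ 0
countBelow-false zero = refl
countBelow-false (suc r) = trans (ℕₚ.+-identityʳ _) (countBelow-false r)

countBelow-at : ∀ l r → countBelow (at l) r ≡ countTrue (take r l)
countBelow-at [] r = trans (countBelow-false r) (sym (cong countTrue (Listₚ.take-[] r)))
countBelow-at (b ∷ l) zero = refl
countBelow-at (b ∷ l) (suc r) =
  trans (countBelow-suc (at (b ∷ l)) r) (trans (cong (λ c → bit b + c) (countBelow-at l r)) (sym (countTrue-∷ b (take r l))))

countBelow-+ : ∀ P Q R → (∀ j → bit (P j) ≡ bit (Q j) + bit (R j)) →
  ∀ r → countBelow P r ≡ countBelow Q r + countBelow R r
countBelow-+ P Q R split zero = refl
countBelow-+ P Q R split (suc r) =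
  trans (cong₂ _+_ (countBelow-+ P Q R split r) (split r)) (+-interchange (countBelow Q r) _ _ _)

countBelow-complement : ∀ P Q → (∀ j → bit (P j) + bit (Q j) ≡ 1) → ∀ r → countBelow P r + countBelow Q r ≡ r
countBelow-complement P Q one zero = refl
countBelow-complement P Q one (suc r) =
  trans (+-interchange (countBelow P r) _ _ _)
        (trans (cong₂ _+_ (countBelow-complement P Q one r) (one r)) (ℕₚ.+-comm r 1))

-- The gap is returned as a variable g with an equation: stating facts directly about gapOf π s (suc i′)
-- makes the type checker unfold labelOrder, at a prohibitive cost.
LabelledGap : List ℤ → List Bool → ℕ → Set
LabelledGap π s i′ = Σ ℕ λ g → gapOf π s (suc i′) ≡ g × g < length π × at s g ≡ false ×
  2 * suc (g + countTrue (drop (suc g) (des π))) + 1 ≡ 2 * suc i′ + gapWeight (des π) s g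

-- labelOrder lists the gaps as M ∷ reverse A ++ B below, so label i ≥ 1 is entry i − 1 of reverse A ++ B.
module _ (π : List ℤ) (s : List Bool) (ls : length s ≡ length π) (s⊆d : s ⊆ᵇ des π) where
  private
    d = des π
    M = length π
    unstarredDes : ℕ → Bool
    unstarredDes j = at d j ∧ not (at s j)
    plainGap : ℕ → Bool
    plainGap j = not (at s j) ∧ not (at d j)
    A = filterB unstarredDes (upTo M)
    B = filterB plainGap (upTo M)

    des-split : ∀ r → countBelow (at d) r ≡ countBelow unstarredDes r + countBelow (at s) r
    des-split = countBelow-+ (at d) unstarredDes (at s) (λ j → pointwise (at d j) (at s j) (s⊆d j))
      where
      pointwise : ∀ dj sj → (sj ≡ true → dj ≡ true) → bit dj ≡ bit (dj ∧ not sj) + bit sj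
      pointwise true true _ = refl
      pointwise true false _ = refl
      pointwise false false _ = refl
      pointwise false true h with () ← h refl

    gaps-split : ∀ r → countBelow plainGap r + countBelow (at d) r ≡ r
    gaps-split = countBelow-complement plainGap (at d) (λ j → pointwise (at d j) (at s j) (s⊆d j))
      where
      pointwise : ∀ dj sj → (sj ≡ true → dj ≡ true) → bit (not sj ∧ not dj) + bit dj ≡ 1
      pointwise true true _ = refl
      pointwise true false _ = refl
      pointwise false false _ = refl
      pointwise false true h with () ← h refl

    countBelow-all : ∀ l → length l ≡ M → countBelow (at l) M ≡ countTrue l
    countBelow-all l len = trans (countBelow-at l M) (cong countTrue (Listₚ.take-all M l (ℕₚ.≤-reflexive len)))

    countTrue-des : countTrue d ≡ length A + countTrue s
    countTrue-des = trans (sym (countBelow-all d (length-desAux (+ 0) π)))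
      (trans (des-split M) (cong₂ _+_ (sym (length-filterB-upTo unstarredDes M)) (countBelow-all s ls)))

    labels-cover : length A + length B + countTrue s ≡ M
    labels-cover = begin
      length A + length B + countTrue s
        ≡⟨ cong₂ (λ a b → a + b + countTrue s) (length-filterB-upTo unstarredDes M) (length-filterB-upTo plainGap M) ⟩
      countBelow unstarredDes M + countBelow plainGap M + countTrue s
        ≡⟨ cong (λ c → countBelow unstarredDes M + countBelow plainGap M + c) (sym (countBelow-all s ls)) ⟩
      countBelow unstarredDes M + countBelow plainGap M + countBelow (at s) M
        ≡⟨ shuffle (countBelow unstarredDes M) (countBelow plainGap M) (countBelow (at s) M) ⟩
      countBelow plainGap M + (countBelow unstarredDes M + countBelow (at s) M)
        ≡⟨ cong (λ c → countBelow plainGap M + c) (sym (des-split M)) ⟩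
      countBelow plainGap M + countBelow (at d) M
        ≡⟨ gaps-split M ⟩
      M ∎
      where
      open ≡-Reasoning
      shuffle : ∀ a b c → a + b + c ≡ b + (a + c)
      shuffle = ℕSolver.solve-∀

    split-at-suc : ∀ l g → countTrue l ≡ countBelow (at l) (suc g) + countTrue (drop (suc g) l)
    split-at-suc l g = trans (countTrue-take-drop (suc g) l) (cong (_+ countTrue (drop (suc g) l)) (sym (countBelow-at l (suc g))))

  gapOf-unstarredDes : ∀ i′ → i′ < length A → Σ ℕ λ g → gapOf π s (suc i′) ≡ g ×
    g < M × at s g ≡ false × at d g ≡ true × countTrue (drop (suc g) d) ≡ countTrue (drop (suc g) s) + i′
  gapOf-unstarredDes i′ i′<A with nthOr-filterB-upTo unstarredDes M jA (ℕₚ.∸-monoʳ-< {length A} {suc i′} {0} (s≤s z≤n) i′<A)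
    where jA = length A ∸ suc i′
  ... | g , nth , g<M , fresh , below with ∧-not-≡true⁻ (at d g) (at s g) fresh
  ...   | dg , sg = g , label≡g , g<M , sg , dg , tail
    where
    jA = length A ∸ suc i′
    label≡g : gapOf π s (suc i′) ≡ g
    label≡g = trans (nthOr-++ˡ 0 (reverse A) B i′ (subst (i′ <_) (sym (Listₚ.length-reverse A)) i′<A))
                    (trans (nthOr-reverse 0 A i′ i′<A) nth)
    Ts = countBelow (at s) (suc g)
    cD = countTrue (drop (suc g) d)
    cW = countTrue (drop (suc g) s)
    tail : cD ≡ cW + i′
    tail = ℕₚ.+-cancelˡ-≡ (jA + 1 + Ts) _ _ (begin
      jA + 1 + Ts + cD
        ≡⟨ cong (λ c → c + 1 + Ts + cD) (sym below) ⟩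
      countBelow unstarredDes g + 1 + Ts + cD
        ≡⟨ cong (λ b → countBelow unstarredDes g + bit b + Ts + cD) (sym fresh) ⟩
      countBelow unstarredDes (suc g) + Ts + cD
        ≡⟨ cong (_+ cD) (sym (des-split (suc g))) ⟩
      countBelow (at d) (suc g) + cD
        ≡⟨ sym (split-at-suc d g) ⟩
      countTrue d
        ≡⟨ countTrue-des ⟩
      length A + countTrue s
        ≡⟨ cong₂ _+_ (sym (ℕₚ.m∸n+n≡m i′<A)) (split-at-suc s g) ⟩
      jA + suc i′ + (Ts + cW)
        ≡⟨ shuffle jA i′ Ts cW ⟩
      jA + 1 + Ts + (cW + i′) ∎)
      where
      open ≡-Reasoning
      shuffle : ∀ j i t w → j + suc i + (t + w) ≡ j + 1 + t + (w + i)
      shuffle = ℕSolver.solve-∀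

  gapOf-plainGap : ∀ i′ → length A ≤ i′ → i′ < length A + length B → Σ ℕ λ g → gapOf π s (suc i′) ≡ g ×
    g < M × at s g ≡ false × at d g ≡ false × i′ + countTrue s ≡ g + countTrue (drop (suc g) d)
  gapOf-plainGap i′ A≤i′ i′<AB with nthOr-filterB-upTo plainGap M (i′ ∸ length A)
                                       (subst (i′ ∸ length A <_) (ℕₚ.m+n∸m≡n (length A) (length B)) (ℕₚ.∸-monoˡ-< i′<AB A≤i′))
  ... | g , nth , g<M , plain , below with not-∧-not-≡true⁻ (at s g) (at d g) plain
  ...   | sg , dg = g , label≡g , g<M , sg , dg , count
    where
    jB = i′ ∸ length A
    A+jB : length A + jB ≡ i′
    A+jB = ℕₚ.m+[n∸m]≡n A≤i′
    label≡g : gapOf π s (suc i′) ≡ g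
    label≡g = trans (subst (λ z → nthOr 0 (reverse A ++ B) z ≡ nthOr 0 B jB)
                           (trans (cong (_+ jB) (Listₚ.length-reverse A)) A+jB) (nthOr-++ʳ 0 (reverse A) B jB)) nth
    cD = countTrue (drop (suc g) d)
    count : i′ + countTrue s ≡ g + cD
    count = begin
      i′ + countTrue s                                 ≡⟨ cong (_+ countTrue s) (sym A+jB) ⟩
      length A + jB + countTrue s                      ≡⟨ shuffle (length A) jB (countTrue s) ⟩
      jB + (length A + countTrue s)                    ≡⟨ cong (λ c → jB + c) (sym countTrue-des) ⟩
      jB + countTrue d                                 ≡⟨ cong (λ c → jB + c) (split-at-suc d g) ⟩
      jB + (countBelow (at d) g + bit (at d g) + cD)   ≡⟨ cong (λ b → jB + (countBelow (at d) g + bit b + cD)) dg ⟩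
      jB + (countBelow (at d) g + 0 + cD)              ≡⟨ regroup jB (countBelow (at d) g) cD ⟩
      jB + countBelow (at d) g + cD                    ≡⟨ cong (λ j → j + countBelow (at d) g + cD) (sym below) ⟩
      countBelow plainGap g + countBelow (at d) g + cD ≡⟨ cong (_+ cD) (gaps-split g) ⟩
      g + cD ∎
      where
      open ≡-Reasoning
      shuffle : ∀ a j k → a + j + k ≡ j + (a + k)
      shuffle = ℕSolver.solve-∀
      regroup : ∀ j c e → j + (c + 0 + e) ≡ j + c + e
      regroup = ℕSolver.solve-∀

  private
    weight-at-unstarredDes : ∀ g i′ → at d g ≡ true →
      countTrue (drop (suc g) d) ≡ countTrue (drop (suc g) s) + i′ →
      2 * suc (g + countTrue (drop (suc g) d)) + 1 ≡ 2 * suc i′ + gapWeight d s g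
    weight-at-unstarredDes g i′ dg tail = begin
      2 * suc (g + cD) + 1                ≡⟨ cong (λ c → 2 * suc (g + c) + 1) tail ⟩
      2 * suc (g + (cW + i′)) + 1         ≡⟨ shuffle g cW i′ ⟩
      2 * suc i′ + (2 * g + 2 * cW + 1)   ≡⟨ cong (λ e → 2 * suc i′ + (2 * (if e then g else cL) + 2 * cW + 1)) (sym dg) ⟩
      2 * suc i′ + gapWeight d s g ∎
      where
      open ≡-Reasoning
      cD = countTrue (drop (suc g) d)
      cL = countTrue (take g s)
      cW = countTrue (drop (suc g) s)
      shuffle : ∀ g w i → 2 * suc (g + (w + i)) + 1 ≡ 2 * suc i + (2 * g + 2 * w + 1)
      shuffle = ℕSolver.solve-∀

    weight-at-plainGap : ∀ g i′ → g < M → at s g ≡ false → at d g ≡ false →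
      i′ + countTrue s ≡ g + countTrue (drop (suc g) d) →
      2 * suc (g + countTrue (drop (suc g) d)) + 1 ≡ 2 * suc i′ + gapWeight d s g
    weight-at-plainGap g i′ g<M sg dg count = begin
      2 * suc (g + cD) + 1                ≡⟨ cong (λ c → 2 * suc c + 1) (sym count) ⟩
      2 * suc (i′ + countTrue s) + 1      ≡⟨ cong (λ c → 2 * suc (i′ + c) + 1) stars-around ⟩
      2 * suc (i′ + (cL + cW)) + 1        ≡⟨ shuffle i′ cL cW ⟩
      2 * suc i′ + (2 * cL + 2 * cW + 1)  ≡⟨ cong (λ e → 2 * suc i′ + (2 * (if e then g else cL) + 2 * cW + 1)) (sym dg) ⟩
      2 * suc i′ + gapWeight d s g ∎
      where
      open ≡-Reasoning
      cD = countTrue (drop (suc g) d)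
      cL = countTrue (take g s)
      cW = countTrue (drop (suc g) s)
      stars-around : countTrue s ≡ cL + cW
      stars-around = trans (countTrue-take-drop g s)
        (cong (λ l → cL + countTrue l) (trans (drop-at g s (subst (g <_) (sym ls) g<M)) (cong (_∷ drop (suc g) s) sg)))
      shuffle : ∀ i l w → 2 * suc (i + (l + w)) + 1 ≡ 2 * suc i + (2 * l + 2 * w + 1)
      shuffle = ℕSolver.solve-∀

  gapOf-weight : ∀ i′ → suc i′ + countTrue s ≤ M → LabelledGap π s i′
  gapOf-weight i′ fits = [ plainGapCase , unstarredDesCase ]′ (ℕₚ.≤-<-connex (length A) i′)
    where
    unstarredDesCase : i′ < length A → LabelledGap π s i′
    unstarredDesCase i′<A = weigh (gapOf-unstarredDes i′ i′<A)
      where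
      weigh : (Σ ℕ λ g → gapOf π s (suc i′) ≡ g × g < M × at s g ≡ false × at d g ≡ true ×
                countTrue (drop (suc g) d) ≡ countTrue (drop (suc g) s) + i′) → LabelledGap π s i′
      weigh (g , label , g<M , sg , dg , tail) = g , label , g<M , sg , weight-at-unstarredDes g i′ dg tail
    plainGapCase : length A ≤ i′ → LabelledGap π s i′
    plainGapCase A≤i′ = weigh (gapOf-plainGap i′ A≤i′ i′<A+B)
      where
      i′<A+B : i′ < length A + length B
      i′<A+B = ℕₚ.+-cancelʳ-≤ (countTrue s) (suc i′) (length A + length B) (ℕₚ.≤-trans fits (ℕₚ.≤-reflexive (sym labels-cover)))
      weigh : (Σ ℕ λ g → gapOf π s (suc i′) ≡ g × g < M × at s g ≡ false × at d g ≡ false ×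
                i′ + countTrue s ≡ g + countTrue (drop (suc g) d)) → LabelledGap π s i′
      weigh (g , label , g<M , sg , dg , count) = g , label , g<M , sg , weight-at-plainGap g i′ g<M sg dg count

length-insertAt : ∀ x g p → length (proj₂ (insertAt x g p)) ≡ length (proj₁ (insertAt x g p))
length-insertAt x g (π , s) = trans (Listₚ.length-map _ (upTo (length τ))) (Listₚ.length-upTo (length τ))
  where τ = take g π ++ x ∷ drop g π

cancel-gapWeight : ∀ F₁ K₀ F₀ K₁ u w c i → F₁ + K₀ + w + u ≡ F₀ + K₁ + 2 * suc c → 2 * suc c + 1 ≡ 2 * suc i + w →
  F₁ + K₀ + suc u ≡ F₀ + K₁ + 2 * suc i
cancel-gapWeight F₁ K₀ F₀ K₁ u w c i inserted weight = ℕₚ.+-cancelʳ-≡ w _ _ (begin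
  F₁ + K₀ + suc u + w             ≡⟨ shuffle F₁ K₀ u w ⟩
  F₁ + K₀ + w + u + 1             ≡⟨ cong (_+ 1) inserted ⟩
  F₀ + K₁ + 2 * suc c + 1         ≡⟨ ℕₚ.+-assoc (F₀ + K₁) _ 1 ⟩
  F₀ + K₁ + (2 * suc c + 1)       ≡⟨ cong (λ z → F₀ + K₁ + z) weight ⟩
  F₀ + K₁ + (2 * suc i + w)       ≡⟨ sym (ℕₚ.+-assoc (F₀ + K₁) _ w) ⟩
  F₀ + K₁ + 2 * suc i + w ∎)
  where
  open ≡-Reasoning
  shuffle : ∀ F K u w → F + K + suc u + w ≡ F + K + w + u + 1
  shuffle = ℕSolver.solve-∀

fmajS-insert-weighted : ∀ x π s g i′ → (∀ a → a ∈ π → ∣ a ∣ < ∣ x ∣) → 0 < ∣ x ∣ →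
  length s ≡ length π → s ⊆ᵇ des π → g < length π → at s g ≡ false →
  2 * suc (g + countTrue (drop (suc g) (des π))) + 1 ≡ 2 * suc i′ + gapWeight (des π) s g →
  fmajS (insertAt x g (π , s)) ≡ fmajS (π , s) ℤ.+ + (2 * suc i′) ℤ.- + suc (bit (isNeg x))
fmajS-insert-weighted x π s g i′ small 0<x ls s⊆d g<π sg weight =
  fmajS-shift (π , s) (insertAt x g (π , s)) (2 * suc i′) (suc (bit (isNeg x))) ls (length-insertAt x g (π , s))
    (cancel-gapWeight (fmajS⁺ (insertAt x g (π , s))) (fmajS⁻ (π , s)) (fmajS⁺ (π , s)) (fmajS⁻ (insertAt x g (π , s)))
                      (bit (isNeg x)) (gapWeight (des π) s g) (g + countTrue (drop (suc g) (des π))) i′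
                      (fmajS-insert x π s g small 0<x ls s⊆d g<π sg) weight)

fmajS-phi-labelled : ∀ x π s i′ → (∀ a → a ∈ π → ∣ a ∣ < ∣ x ∣) → 0 < ∣ x ∣ →
  length s ≡ length π → s ⊆ᵇ des π → LabelledGap π s i′ →
  fmajS (phi x (suc i′) (π , s)) ≡ fmajS (π , s) ℤ.+ + (2 * suc i′) ℤ.- + suc (bit (isNeg x))
fmajS-phi-labelled x π s i′ small 0<x ls s⊆d (g , label , g<π , sg , weight) =
  trans (cong fmajS (phi-at-gap x (suc i′) π s g label)) (fmajS-insert-weighted x π s g i′ small 0<x ls s⊆d g<π sg weight)

fmajS-insert-last : ∀ x π s → isNeg x ≡ true → does (x ℤ.<? lastOr (+ 0) π) ≡ true → length s ≡ length π →
  fmajS (insertAt x (length π) (π , s)) ≡ fmajS (π , s) ℤ.+ + (2 * suc (length π)) ℤ.- + (2 * suc (countTrue s))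
fmajS-insert-last x π s x<0 x<last ls =
  fmajS-shift (π , s) (insertAt x (length π) (π , s)) (2 * suc (length π)) (2 * suc (countTrue s)) ls
    (length-insertAt x (length π) (π , s))
    (arith (fmajS⁺ (insertAt x (length π) (π , s))) (fmajS⁻ (π , s)) (fmajS⁺ (π , s)) (fmajS⁻ (insertAt x (length π) (π , s)))
           (countTrue s) (length π) (bit (isNeg x)) (cong bit x<0) (fmajS-insert-end x π s x<last ls))
  where
  arith : ∀ F₁ K₀ F₀ K₁ c m u → u ≡ 1 → F₁ + K₀ + (2 * c + 1) ≡ F₀ + K₁ + (2 * m + u) →
    F₁ + K₀ + 2 * suc c ≡ F₀ + K₁ + 2 * suc m
  arith F₁ K₀ F₀ K₁ c m .1 refl eq = trans (shuffle F₁ K₀ c) (trans (cong suc eq) (sym (shuffle F₀ K₁ m)))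
    where
    shuffle : ∀ F K c → F + K + 2 * suc c ≡ suc (F + K + (2 * c + 1))
    shuffle = ℕSolver.solve-∀

entries-below : ∀ m π → IsSignedPerm m π → ∀ a → a ∈ π → ∣ a ∣ < suc m
entries-below m π perm a a∈π with ∈ₚ.∈-map⁻ suc (↭ₚ.∈-resp-↭ perm (∈ₚ.∈-map⁺ ∣_∣ a∈π))
... | j , j∈ , a≡ = subst (_< suc m) (sym a≡) (s≤s (∈ₚ.∈-upTo⁻ j∈))

length-signedPerm : ∀ m π → IsSignedPerm m π → length π ≡ m
length-signedPerm m π perm = trans (sym (Listₚ.length-map ∣_∣ π))
  (trans (↭ₚ.↭-length perm) (trans (Listₚ.length-map suc (upTo m)) (Listₚ.length-upTo m)))

lemma2p6 : (n k : ℕ) → 1 ≤ k → k ≤ n →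
    (π : List ℤ) (s : List Bool) → InBgt (n ∸ 1) (k ∸ 1) π s →
    ((i : ℕ) → 1 ≤ i → i ≤ n ∸ k →
      fmajS (phiPos n i (π , s)) ≡ fmajS (π , s) ℤ.+ + (2 * i) ℤ.- + 1)
    × ((i : ℕ) → 1 ≤ i → i ≤ n ∸ k →
      fmajS (phiNeg n i (π , s)) ≡ fmajS (π , s) ℤ.+ + (2 * i) ℤ.- + 2)
    × (fmajS (phiNeg n 0 (π , s)) ≡ fmajS (π , s) ℤ.+ + (2 * n) ℤ.- + (2 * k))
lemma2p6 (suc n′) (suc k′) _ (s≤s k′≤n′) π s (perm , len-s , stars⊆des , stars) =
  insert (+ suc n′) small (s≤s z≤n) , insert -[1+ n′ ] small (s≤s z≤n) , insert-last
  where
  small = entries-below n′ π perm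
  len-π = length-signedPerm n′ π perm
  ls = trans len-s (sym len-π)
  s⊆d : s ⊆ᵇ des π
  s⊆d j sj = T⇒≡true (stars⊆des j (subst T (sym sj) _))
  fits : ∀ i′ → suc i′ ≤ n′ ∸ k′ → suc i′ + countTrue s ≤ length π
  fits i′ i≤ = subst₂ (λ c m → suc i′ + c ≤ m) (sym stars) (sym len-π)
                      (subst (suc i′ + k′ ≤_) (ℕₚ.m∸n+n≡m k′≤n′) (ℕₚ.+-monoˡ-≤ k′ i≤))
  insert : ∀ x → (∀ a → a ∈ π → ∣ a ∣ < ∣ x ∣) → 0 < ∣ x ∣ → (i : ℕ) → 1 ≤ i → i ≤ n′ ∸ k′ →
    fmajS (phi x i (π , s)) ≡ fmajS (π , s) ℤ.+ + (2 * i) ℤ.- + suc (bit (isNeg x))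
  insert x below-x 0<x (suc i′) _ i≤ = fmajS-phi-labelled x π s i′ below-x 0<x ls s⊆d (gapOf-weight π s ls s⊆d i′ (fits i′ i≤))
  insert-last : fmajS (phiNeg (suc n′) 0 (π , s)) ≡ fmajS (π , s) ℤ.+ + (2 * suc n′) ℤ.- + (2 * suc k′)
  insert-last = trans (cong fmajS (phi-at-gap -[1+ n′ ] 0 π s (length π) refl))
    (trans (fmajS-insert-last -[1+ n′ ] π s refl x<last ls)
           (cong₂ (λ m c → fmajS (π , s) ℤ.+ + (2 * suc m) ℤ.- + (2 * suc c)) len-π stars))
    where
    x<last = proj₁ (<?-extreme -[1+ n′ ] (lastOr (+ 0) π) (lastOr-All (λ a → ∣ a ∣ < suc n′) (+ 0) π (s≤s z≤n) small))
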